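{- For every integer $k\ge 1$, \[ R(H_{3,4k}) = C(H_{3,4k}) - 3 + (2k+3)2^{ -k}, \] \[ R(H_{3,4k+2}) = C(H_{3,4k+2}) - 3 + 3(k+2)2^{ -1-k}. \]
   Context: For a finite simple undirected graph $G$, the closeness is $C(G)=\sum_{i}\sum_{j\ne i}2^{ -d(i,j)}$, where the sum is over all ordered pairs of distinct vertices, $d(i,j)$ is the graph distance, and $2^{ -d(i,j)}=0$ if $i$ and $j$ lie in different components. The link residual closeness is $R(G)=\min_{(r,s)} C(G_{r,s})$, where the minimum is over all edges (links) $(r,s)$ of $G$ and $G_{r,s}$ is the graph obtained from $G$ by deleting the edge $(r,s)$ (keeping all vertices). For an integer $n\ge 2$, the Harary graph $H_{3,2n}$ has vertices $1,2,\dots,2n$ placed in a circle in this order, each vertex being joined to its nearest vertex in each direction along the circle and to the diametrically opposite vertex (so the edges are those of the cycle $1,2,\dots,2n,1$ together with the links $(i,i+n)$ for $1\le i\le n$). -}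

module Defs where

open import Algebra.Definitions.RawSemiring using (sum; _^_)
open import Data.Fin.Base using (Fin; zero; suc; toℕ)
import Data.Fin.Properties as Fin
open import Data.Fin.Properties using (_≟_)
open import Data.Integer.Base using (+_)
open import Data.Nat.Base as ℕ using (ℕ; zero; suc; z≤n; s≤s)
open import Data.Nat.Induction using (<-rec)
import Data.Nat.Properties as ℕ
open import Data.Product using (∃; ∃-syntax; _×_; _,_)
open import Data.Rational.Base using (ℚ; 0ℚ; ½; _/_; _≤_; +-*-rawSemiring)
open import Data.Sum.Base using (_⊎_; inj₁; inj₂; swap)
open import Function.Base using (_∘_)
open import Level using (0ℓ)
open import Relation.Binary using (Rel; Decidable; Symmetric; Irreflexive)
open import Relation.Binary.PropositionalEquality
  using (_≡_; refl; sym; trans; cong; subst)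
open import Relation.Nullary using (¬_; Dec; yes; no; contradiction; ¬?)
open import Relation.Nullary.Decidable using (_×-dec_; _⊎-dec_)

record Graph (n : ℕ) : Set₁ where
  field
    Adj        : Rel (Fin n) 0ℓ
    adj?       : Decidable Adj
    adj-sym    : Symmetric Adj
    adj-irrefl : Irreflexive _≡_ Adj

open Graph public

private
  variable
    n d e : ℕ
    i j l : Fin n

SameLink : (r s i j : Fin n) → Set
SameLink r s i j = (i ≡ r × j ≡ s) ⊎ (i ≡ s × j ≡ r)

deleteLink : Graph n → (r s : Fin n) → Graph n
deleteLink G r s = record
  { Adj        = λ i j → Adj G i j × ¬ SameLink r s i j
  ; adj?       = λ i j → adj? G i j ×-dec
                   ¬? ((i ≟ r ×-dec j ≟ s) ⊎-dec (i ≟ s ×-dec j ≟ r))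
  ; adj-sym    = λ (a , ¬same) → adj-sym G a , ¬same ∘ flipLink
  ; adj-irrefl = λ eq (a , _) → adj-irrefl G eq a
  }
  where
  flipLink : ∀ {i j} → SameLink r s j i → SameLink r s i j
  flipLink (inj₁ (p , q)) = inj₂ (q , p)
  flipLink (inj₂ (p , q)) = inj₁ (q , p)

data Walk (G : Graph n) : (i j : Fin n) → ℕ → Set where
  []  : Walk G i i 0
  _∷_ : Adj G i j → Walk G j l d → Walk G i l (suc d)

IsDistance : Graph n → (i j : Fin n) → ℕ → Set
IsDistance G i j d = Walk G i j d × (∀ {e} → Walk G i j e → d ℕ.≤ e)

module _ (G : Graph n) where

  walk? : ∀ i j d → Dec (Walk G i j d)
  walk? i j zero with i ≟ j
  ... | yes refl = yes []
  ... | no i≢j   = no λ { [] → i≢j refl }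
  walk? i j (suc d) with Fin.any? (λ l → adj? G i l ×-dec walk? l j d)
  ... | yes (_ , a , w) = yes (a ∷ w)
  ... | no ¬w           = no λ { (a ∷ w) → ¬w (_ , a , w) }

  shortestWalk : ∀ {i j} d → Walk G i j d → ∃ (IsDistance G i j)
  shortestWalk {i} {j} = <-rec _ step
    where
    step : ∀ d → (∀ {e} → e ℕ.< d → Walk G i j e → ∃ (IsDistance G i j)) →
           Walk G i j d → ∃ (IsDistance G i j)
    step d rec w with ℕ.anyUpTo? (walk? i j) d
    ... | yes (_ , e<d , w′) = rec e<d w′
    ... | no ¬shorter        =
      d , w , λ w′ → ℕ.≮⇒≥ λ e<d → ¬shorter (_ , e<d , w′)

  private
    vertex : Walk G i j d → Fin (suc d) → Fin n
    vertex {i = i} _  zero    = i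
    vertex (_ ∷ w)    (suc p) = vertex w p

    take : (w : Walk G i j d) (p : Fin (suc d)) → Walk G i (vertex w p) (toℕ p)
    take w       zero    = []
    take (a ∷ w) (suc p) = a ∷ take w p

    drop : (w : Walk G i j d) (p : Fin (suc d)) →
           Walk G (vertex w p) j (d ℕ.∸ toℕ p)
    drop w       zero    = w
    drop (a ∷ w) (suc p) = drop w p

    _++_ : Walk G i j d → Walk G j l e → Walk G i l (d ℕ.+ e)
    []      ++ w′ = w′
    (a ∷ w) ++ w′ = a ∷ (w ++ w′)

  shorten : Walk G i j d → n ℕ.≤ d → ∃[ e ] e ℕ.< d × Walk G i j e
  shorten {j = j} {d = d} w n≤d with Fin.pigeonhole (s≤s n≤d) (vertex w)
  ... | p , q , p<q , vp≡vq =
    _ , shorter , take w p ++ subst (λ v → Walk G v j _) (sym vp≡vq) (drop w q)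
    where
    open ℕ.≤-Reasoning
    shorter : toℕ p ℕ.+ (d ℕ.∸ toℕ q) ℕ.< d
    shorter = begin-strict
      toℕ p ℕ.+ (d ℕ.∸ toℕ q) <⟨ ℕ.+-monoˡ-< (d ℕ.∸ toℕ q) p<q ⟩
      toℕ q ℕ.+ (d ℕ.∸ toℕ q) ≡⟨ ℕ.m+[n∸m]≡n (Fin.toℕ≤pred[n] q) ⟩
      d                       ∎

  distance? : ∀ i j → Dec (∃ (IsDistance G i j))
  distance? i j with ℕ.anyUpTo? (walk? i j) n
  ... | yes (d , _ , w) = yes (shortestWalk d w)
  ... | no ¬w           = no λ (d , w , min) →
    let e , e<d , w′ = shorten w (ℕ.≮⇒≥ λ d<n → ¬w (d , d<n , w))
    in ℕ.<⇒≱ e<d (min w′)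

Σℚ : (Fin n → ℚ) → ℚ
Σℚ = sum +-*-rawSemiring

½^_ : ℕ → ℚ
½^ d = _^_ +-*-rawSemiring ½ d

infix 8 ½^_

fromℕ : ℕ → ℚ
fromℕ m = + m / 1

2^-distance : Graph n → (i j : Fin n) → ℚ
2^-distance G i j with distance? G i j
... | yes (d , _) = ½^ d
... | no _        = 0ℚ

offDiagonal : (Fin n → Fin n → ℚ) → Fin n → Fin n → ℚ
offDiagonal f i j with i ≟ j
... | yes _ = 0ℚ
... | no _  = f i j

closeness : Graph n → ℚ
closeness G = Σℚ λ i → Σℚ λ j → offDiagonal (2^-distance G) i j

-- The minimum is a relation because it does not exist for a graph without
-- links; the rational satisfying it is unique.
IsLinkResidualCloseness : Graph n → ℚ → Set
IsLinkResidualCloseness G c =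
  (∃[ r ] ∃[ s ] Adj G r s × closeness (deleteLink G r s) ≡ c) ×
  (∀ r s → Adj G r s → c ≤ closeness (deleteLink G r s))

-- Vertices are numbered from 0, so vertex v of the circle 1, …, 2n is v - 1.
module _ (n : ℕ) where

  Next : (i j : Fin (2 ℕ.* n)) → Set
  Next i j = suc (toℕ i) ≡ toℕ j ⊎ (suc (toℕ i) ≡ 2 ℕ.* n × toℕ j ≡ 0)

  Opposite : (i j : Fin (2 ℕ.* n)) → Set
  Opposite i j = toℕ i ℕ.+ n ≡ toℕ j

  HararyAdj : (i j : Fin (2 ℕ.* n)) → Set
  HararyAdj i j = (Next i j ⊎ Next j i) ⊎ (Opposite i j ⊎ Opposite j i)

  harary : 2 ℕ.≤ n → Graph (2 ℕ.* n)
  harary 2≤n = record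
    { Adj        = HararyAdj
    ; adj?       = λ i j → (next? i j ⊎-dec next? j i)
                             ⊎-dec (opposite? i j ⊎-dec opposite? j i)
    ; adj-sym    = λ { (inj₁ a) → inj₁ (swap a) ; (inj₂ a) → inj₂ (swap a) }
    ; adj-irrefl = λ { refl (inj₁ (inj₁ a)) → ¬next a
                     ; refl (inj₁ (inj₂ a)) → ¬next a
                     ; refl (inj₂ (inj₁ a)) → ¬opposite a
                     ; refl (inj₂ (inj₂ a)) → ¬opposite a }
    }
    where
    next? : Decidable Next
    next? i j = (suc (toℕ i) ℕ.≟ toℕ j)
                  ⊎-dec ((suc (toℕ i) ℕ.≟ 2 ℕ.* n) ×-dec (toℕ j ℕ.≟ 0))

    opposite? : Decidable Opposite
    opposite? i j = toℕ i ℕ.+ n ℕ.≟ toℕ j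

    ¬next : ∀ {i} → ¬ Next i i
    ¬next (inj₁ eq)        = ℕ.1+n≢n eq
    ¬next (inj₂ (eq , i≡0)) = ℕ.<⇒≢ 1<2n (trans (cong suc (sym i≡0)) eq)
      where
      1<2n : 1 ℕ.< 2 ℕ.* n
      1<2n = ℕ.≤-trans 2≤n (ℕ.m≤m+n n _)

    ¬opposite : ∀ {i} → ¬ Opposite i i
    ¬opposite {i} eq = ℕ.<⇒≢ (ℕ.m<m+n (toℕ i) (ℕ.<-trans ℕ.0<1+n 2≤n)) (sym eq)

-- 4k and 4k + 2 are 2n for n = 2k and n = 2k + 1.
module _ {k : ℕ} (1≤k : 1 ℕ.≤ k) where

  2≤2k : 2 ℕ.≤ 2 ℕ.* k
  2≤2k = ℕ.*-monoʳ-≤ 2 1≤k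

  2≤2k+1 : 2 ℕ.≤ 2 ℕ.* k ℕ.+ 1
  2≤2k+1 = ℕ.m≤n⇒m≤n+o 1 2≤2k

{-# OPTIONS --safe #-}
module Submission where

-- Let H be the graph on 2n vertices and P be H without the link (2n - 1 , 0).  For |i - j| = m, a
-- shortest walk of H runs along the circle (m or 2n - m steps) or uses one chord (1 + |n - m|
-- steps).  In P the walk of 2n - m steps is cut, and with two chords it is replaced by one of
-- 2n - m + 2 steps.  So only pairs with s = 2n - m ≤ n/2 move apart: from s to s + 2, or to s + 1
-- if 2s = n.  There are s such pairs i < j for each s, which gives the value of C(H) - C(P).
-- Rotations turn every rim link into (2n - 1 , 0).  Every link at an end of a chord lies on a
-- 4-cycle through that chord, so deleting the chord affects the distance of its ends only.  That
-- costs 3/4 (1/2 if n = 2), never more than deleting a rim link.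

-- A lower bound on all walks cannot be read off a single walk, so it is carried as an invariant:
-- the disjunction of the three route lengths survives prefixing a link. Cutting (2n - 1 , 0) turns
-- the rim into a path with rim distance |i - j|, so this one number governs both graphs. For m ≥ n
-- the chord route has 1 + n - s steps. The route of s steps beats it exactly if 2s ≤ n, and the
-- detour of s + 2 steps is no longer than it exactly if 2s < n. The case 2s = n occurs for even n
-- only, which is why there are two formulas. For chords an inequality suffices. The loss is at most
-- 2 (1/2 - 1/8) = 3/4, and a rim link costs 3 - a, where a is the last term of the claimed value.
-- So a ≤ 9/4 is wanted: an equality for H₃,₆, and false only for H₃,₄, where a = 5/2.

module _ where
  open import Data.List.Base using ([]; _∷_)
  open import Data.Nat.Base
  open import Data.Nat.Properties
  open import Data.Nat.Tactic.RingSolver using (solve)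
  open import Data.Product using (_,_)
  open import Data.Sum.Base using (inj₁; inj₂)
  open import Relation.Binary.PropositionalEquality

  -- Walk lengths as inequalities between natural numbers.

  private variable c e n m m′ s t d : ℕ

  -- Linear arithmetic by certificate: a ≤ b is a sum of hypotheses and s is the slack.
  lin : ∀ {a b x y} s → a ≤ b → x + b + s ≡ y + a → x ≤ y
  lin {a} {b} {x} {y} s a≤b eq = +-cancelʳ-≤ a x y (begin
    x + a     ≤⟨ +-monoʳ-≤ x a≤b ⟩
    x + b     ≤⟨ m≤m+n (x + b) s ⟩
    x + b + s ≡⟨ eq ⟩
    y + a     ∎)
    where open ≤-Reasoning

  infixl 6 _⊞_
  _⊞_ : ∀ {a b x y} → a ≤ b → x ≤ y → a + x ≤ b + y
  _⊞_ = +-mono-≤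

  -- Lower bounds on the length d of a walk between vertices with |i - j| = m, written without
  -- subtraction: m, 1 + |n - m| and c + 2n - m.  Here c = 0 for H and c = 2 for P.
  data Route (c n m d : ℕ) : Set where
    along  : m ≤ d → Route c n m d
    across : 1 + n ≤ m + d → 1 + m ≤ n + d → Route c n m d
    around : c + 2 * n ≤ m + d → Route c n m d

  -- How |i - j| changes to m′ when i moves along a link of P.
  data Move (n m m′ : ℕ) : Set where
    nearer    : m ≡ 1 + m′ → Move n m m′
    farther   : m′ ≡ 1 + m → Move n m m′
    chord⁺    : m′ ≡ m + n → Move n m m′
    chord⁻    : m ≡ m′ + n → Move n m m′
    reflected : m + m′ ≡ n → Move n m m′

  -- A rim link changes each of the three lengths by at most one, and a chord may trade one route
  -- for another. The bound `c ≤ 2` enters where a chord precedes a route that already uses one: two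
  -- chords imitate the way around at an extra cost of 2.
  move-route : c ≤ 2 → m′ ≤ 2 * n → Move n m m′ → Route c n m′ d → Route c n m (1 + d)
  move-route {c} {m′} {n} {m} {d} c≤2 _ (nearer refl) (along p) =
    along (lin 0 p (solve (m′ ∷ d ∷ [])))
  move-route {c} {m′} {n} {m} {d} c≤2 _ (nearer refl) (across p q) =
    across (lin 2 p (solve (n ∷ m′ ∷ d ∷ []))) (lin 0 q (solve (n ∷ m′ ∷ d ∷ [])))
  move-route {c} {m′} {n} {m} {d} c≤2 _ (nearer refl) (around p) =
    around (lin 2 p (solve (c ∷ n ∷ m′ ∷ d ∷ [])))
  move-route {c} {m′} {n} {m} {d} c≤2 _ (farther refl) (along p) =
    along (lin 2 p (solve (m ∷ d ∷ [])))
  move-route {c} {m′} {n} {m} {d} c≤2 _ (farther refl) (across p q) =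
    across (lin 0 p (solve (n ∷ m ∷ d ∷ []))) (lin 2 q (solve (n ∷ m ∷ d ∷ [])))
  move-route {c} {m′} {n} {m} {d} c≤2 _ (farther refl) (around p) =
    around (lin 0 p (solve (c ∷ n ∷ m ∷ d ∷ [])))
  move-route {c} {m′} {n} {m} {d} c≤2 _ (chord⁺ refl) (along p) =
    along (lin (1 + n) p (solve (n ∷ m ∷ d ∷ [])))
  move-route {c} {m′} {n} {m} {d} c≤2 _ (chord⁺ refl) (across p q) =
    along (lin 2 q (solve (n ∷ m ∷ d ∷ [])))
  move-route {c} {m′} {n} {m} {d} c≤2 r (chord⁺ refl) (around p) =
    across (lin c p (solve (c ∷ n ∷ m ∷ d ∷ []))) (lin d r (solve (n ∷ m ∷ d ∷ [])))
  move-route {c} {m′} {n} {m} {d} c≤2 _ (chord⁻ refl) (along p) =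
    across (lin (m′ + m′) p (solve (n ∷ m′ ∷ d ∷ []))) (lin 0 p (solve (n ∷ m′ ∷ d ∷ [])))
  move-route {c} {m′} {n} {m} {d} c≤2 _ (chord⁻ refl) (across p q) =
    around (lin 0 (c≤2 ⊞ p) (solve (c ∷ n ∷ m′ ∷ d ∷ [])))
  move-route {c} {m′} {n} {m} {d} c≤2 _ (chord⁻ refl) (around p) =
    around (lin (1 + n) p (solve (c ∷ n ∷ m′ ∷ d ∷ [])))
  move-route {c} {m′} {n} {m} {d} c≤2 _ (reflected refl) (along p) =
    across (lin 0 p (solve (m ∷ m′ ∷ d ∷ []))) (lin (m′ + d) (z≤n {0}) (solve (m ∷ m′ ∷ d ∷ [])))
  move-route {c} {m′} {n} {m} {d} c≤2 _ (reflected refl) (across p q) =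
    along (lin 2 p (solve (m ∷ m′ ∷ d ∷ [])))
  move-route {c} {m′} {n} {m} {d} c≤2 _ (reflected refl) (around p) =
    along (lin (c + 1 + m + m′) p (solve (c ∷ m ∷ m′ ∷ d ∷ [])))

  -- The link between 2n - 1 and 0 sends |i - j| to 2n - 1 - |i - j|. It exchanges `along` with
  -- `around`, and the two halves of `across`; the first exchange leaves no room for a positive c.
  wrap-route : 1 + (m + m′) ≡ 2 * n → Route 0 n m′ d → Route 0 n m (1 + d)
  wrap-route {m} {m′} {n} {d} eq (along p) =
    around (lin 0 (p ⊞ ≤-reflexive (sym eq)) (solve (n ∷ m ∷ m′ ∷ d ∷ [])))
  wrap-route {m} {m′} {n} {d} eq (across p q) =
    across (lin 0 (q ⊞ ≤-reflexive (sym eq)) (solve (n ∷ m ∷ m′ ∷ d ∷ [])))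
           (lin 2 (p ⊞ ≤-reflexive eq) (solve (n ∷ m ∷ m′ ∷ d ∷ [])))
  wrap-route {m} {m′} {n} {d} eq (around p) =
    along (lin 2 (p ⊞ ≤-reflexive eq) (solve (n ∷ m ∷ m′ ∷ d ∷ [])))

  move-sym : Move n m m′ → Move n m′ m
  move-sym (nearer eq)    = farther eq
  move-sym (farther eq)   = nearer eq
  move-sym (chord⁺ eq)    = chord⁻ eq
  move-sym (chord⁻ eq)    = chord⁺ eq
  move-sym {m = m} (reflected eq) = reflected (trans (+-comm _ m) eq)

  ∣m+n-m∣≡n : ∀ m n → ∣ m + n - m ∣ ≡ n
  ∣m+n-m∣≡n m n = trans (∣-∣-comm (m + n) m) (∣m-m+n∣≡n m n)

  next-move : ∀ i j → Move n ∣ i - j ∣ ∣ suc i - j ∣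
  next-move i j with ≤-<-connex j i
  ... | inj₁ j≤i with o , refl ← m≤n⇒∃[o]m+o≡n j≤i =
    farther (trans (trans (cong ∣_- j ∣ (sym (+-suc j o))) (∣m+n-m∣≡n j (suc o)))
                   (cong suc (sym (∣m+n-m∣≡n j o))))
  ... | inj₂ i<j with o , refl ← m≤n⇒∃[o]m+o≡n i<j =
    nearer (trans (trans (cong (∣ i -_∣) (sym (+-suc i o))) (∣m-m+n∣≡n i (suc o)))
                  (cong suc (sym (∣m-m+n∣≡n i o))))

  opposite-move : ∀ i j → Move n ∣ i - j ∣ ∣ i + n - j ∣
  opposite-move {n} i j with ≤-total j i
  ... | inj₁ j≤i with o , refl ← m≤n⇒∃[o]m+o≡n j≤i =
    chord⁺ (trans (trans (cong ∣_- j ∣ (+-assoc j o n)) (∣m+n-m∣≡n j (o + n)))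
                  (cong (_+ n) (sym (∣m+n-m∣≡n j o))))
  ... | inj₂ i≤j with o , refl ← m≤n⇒∃[o]m+o≡n i≤j
    rewrite ∣m-m+n∣≡n i o | ∣m+n-m+o∣≡∣n-o∣ i n o with ≤-total o n
  ... | inj₁ o≤n with u , refl ← m≤n⇒∃[o]m+o≡n o≤n = reflected (cong (o +_) (∣m+n-m∣≡n o u))
  ... | inj₂ n≤o with u , refl ← m≤n⇒∃[o]m+o≡n n≤o =
    chord⁻ (trans (+-comm n u) (cong (_+ n) (sym (∣m-m+n∣≡n n u))))

  -- Here e is the excess over the s steps through the cut link: 0 in H, and in P 1 if 2s = n and 2
  -- if 2s < n. The hypothesis on `e + 2 * s` says that e + s does not exceed the chord route, 1 + m
  -- - n = 1 + n - s.
  route-bound : 1 ≤ n → s + m ≡ 2 * n → e ≤ c → e + 2 * s ≤ 1 + n → Route c n m d → e + s ≤ d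
  route-bound {n} {s} {m} {e} {c} {d} 1≤n eq _ e+2s≤1+n (along p) =
    lin 0 (1≤n ⊞ ≤-reflexive (sym eq) ⊞ e+2s≤1+n ⊞ p) (solve (n ∷ s ∷ m ∷ e ∷ d ∷ []))
  route-bound {n} {s} {m} {e} {c} {d} _ eq _ e+2s≤1+n (across _ p) =
    lin 0 (≤-reflexive (sym eq) ⊞ e+2s≤1+n ⊞ p) (solve (n ∷ s ∷ m ∷ e ∷ d ∷ []))
  route-bound {n} {s} {m} {e} {c} {d} _ eq e≤c _ (around p) =
    lin 0 (≤-reflexive eq ⊞ e≤c ⊞ p) (solve (n ∷ s ∷ m ∷ e ∷ c ∷ d ∷ []))

  far-apart : s + m ≡ 2 * n → s ≤ n → n ≤ m
  far-apart {s} {m} {n} eq s≤n = lin 0 (s≤n ⊞ ≤-reflexive (sym eq)) (solve (s ∷ m ∷ n ∷ []))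

  complement : s + m ≡ 2 * n → n + t ≡ m → t + s ≡ n
  complement {s} {m} {n} {t} eq refl = +-cancelˡ-≡ n _ _ (begin
    n + (t + s) ≡⟨ solve (n ∷ t ∷ s ∷ []) ⟩
    s + (n + t) ≡⟨ eq ⟩
    2 * n       ≡⟨ solve (n ∷ []) ⟩
    n + n       ∎)
    where open ≡-Reasoning

  around-across : s + m ≡ 2 * n → n + t ≡ m → 1 + n ≤ 2 * s → 2 * n ≤ m + d → 1 + t ≤ d
  around-across {s} {m} {n} {t} {d} eq refl 1+n≤2s p =
    lin 0 (1+n≤2s ⊞ ≤-reflexive eq ⊞ ≤-reflexive eq ⊞ p) (solve (s ∷ n ∷ t ∷ d ∷ []))

  around-along : m ≤ n → 2 * n ≤ m + d → m ≤ d
  around-along {m} {n} {d} m≤n p = lin 0 (m≤n ⊞ m≤n ⊞ p) (solve (m ∷ n ∷ d ∷ []))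

  across-short : m + t ≡ n → 1 + n ≤ m + d → 1 + t ≤ d
  across-short {m} {t} {n} {d} refl p = lin 0 p (solve (m ∷ t ∷ d ∷ []))

open import Defs
open import Data.Fin.Base using (Fin; zero; suc; toℕ; fromℕ<; opposite)
open import Data.Fin.Properties using (_≟_; toℕ<n; toℕ-injective; opposite-prop; toℕ-fromℕ<)
import Data.Fin.Base as Fin
import Data.Fin.Properties as Fin
open import Data.Nat.Base as ℕ using (ℕ; zero; suc; z≤n; s≤s)
import Data.Nat.Properties as ℕ
open import Data.Nat.Tactic.RingSolver using (solve-∀)
open import Data.Product using (∃-syntax; _×_; _,_; proj₁; proj₂)
import Data.Product as Product
import Data.Rational.Base as ℚ
import Data.Rational.Properties as ℚ
open import Data.Sum.Base using (_⊎_; inj₁; inj₂)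
open import Function.Base using (_∘_; id)
open import Relation.Binary.PropositionalEquality
open import Relation.Nullary
open import Relation.Nullary.Decidable using (toWitness; dec-true; _×-dec_; _⊎-dec_)

-- Walks in H and P.

module _ where
  open import Data.Nat.Base
  open import Data.Nat.Properties hiding (_≟_)
  open import Data.Rational.Base using (ℚ; 0ℚ; 1ℚ; ½)

  private variable
    N d e : ℕ

  module _ {G : Graph N} where
    private variable i j l : Fin N

    infixr 5 _++_
    _++_ : Walk G i j d → Walk G j l e → Walk G i l (d + e)
    []      ++ w′ = w′
    (a ∷ w) ++ w′ = a ∷ (w ++ w′)

    link : Adj G i j → Walk G i j 1
    link a = a ∷ []

    reverse : Walk G i j d → Walk G j i d
    reverse []                  = []
    reverse {d = suc d} (a ∷ w) = subst (Walk G _ _) (+-comm d 1) (reverse w ++ link (adj-sym G a))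

  walk-map : ∀ {G G′ : Graph N} (f : Fin N → Fin N) →
             (∀ {i j} → Adj G i j → Adj G′ (f i) (f j)) →
             ∀ {i j} → Walk G i j d → Walk G′ (f i) (f j) d
  walk-map f hom []      = []
  walk-map f hom (a ∷ w) = hom a ∷ walk-map f hom w

  module _ (n : ℕ) (2≤n : 2 ≤ n) where

    private
      H : Graph (2 * n)
      H = harary n 2≤n

    toℕ<2n : (i : Fin (2 * n)) → toℕ i < 2 * n
    toℕ<2n = toℕ<n {2 * n}

    ∣i-j∣≤2n : (i j : Fin (2 * n)) → ∣ toℕ i - toℕ j ∣ ≤ 2 * n
    ∣i-j∣≤2n i j = ≤-trans (∣m-n∣≤m⊔n (toℕ i) (toℕ j)) (⊔-lub (<⇒≤ (toℕ<2n i)) (<⇒≤ (toℕ<2n j)))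

    vertex : ∀ {a} → a < 2 * n → ∃[ v ] toℕ {2 * n} v ≡ a
    vertex a<2n = fromℕ< a<2n , toℕ-fromℕ< a<2n

    next-step : ∀ {i l : Fin (2 * n)} (j : Fin (2 * n)) → suc (toℕ i) ≡ toℕ l →
                Move n ∣ toℕ i - toℕ j ∣ ∣ toℕ l - toℕ j ∣
    next-step {i} j eq =
      subst (λ l → Move n ∣ toℕ i - toℕ j ∣ ∣ l - toℕ j ∣) eq (next-move {n} (toℕ i) (toℕ j))

    opposite-step : ∀ {i l : Fin (2 * n)} (j : Fin (2 * n)) → Opposite n i l →
                    Move n ∣ toℕ i - toℕ j ∣ ∣ toℕ l - toℕ j ∣
    opposite-step {i} j eq =
      subst (λ l → Move n ∣ toℕ i - toℕ j ∣ ∣ l - toℕ j ∣) eq (opposite-move {n} (toℕ i) (toℕ j))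

    Unwrapped : (i l : Fin (2 * n)) → Set
    Unwrapped i l = (suc (toℕ i) ≡ toℕ l ⊎ suc (toℕ l) ≡ toℕ i) ⊎ (Opposite n i l ⊎ Opposite n l i)

    unwrapped-move : ∀ {i l} (j : Fin (2 * n)) → Unwrapped i l →
                     Move n ∣ toℕ i - toℕ j ∣ ∣ toℕ l - toℕ j ∣
    unwrapped-move j (inj₁ (inj₁ eq)) = next-step j eq
    unwrapped-move j (inj₁ (inj₂ eq)) = move-sym (next-step j eq)
    unwrapped-move j (inj₂ (inj₁ o))  = opposite-step j o
    unwrapped-move j (inj₂ (inj₂ o))  = move-sym (opposite-step j o)

    unwrapped-route : ∀ {c i l d} (j : Fin (2 * n)) → c ≤ 2 → Unwrapped i l →
                      Route c n ∣ toℕ l - toℕ j ∣ d → Route c n ∣ toℕ i - toℕ j ∣ (suc d)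
    unwrapped-route {l = l} j c≤2 a = move-route c≤2 (∣i-j∣≤2n l j) (unwrapped-move j a)

    wrap-link : ∀ {i l : Fin (2 * n)} {d} (j : Fin (2 * n)) → suc (toℕ i) ≡ 2 * n → toℕ l ≡ 0 →
                Route 0 n ∣ toℕ l - toℕ j ∣ d → Route 0 n ∣ toℕ i - toℕ j ∣ (suc d)
    wrap-link {i} {l} j eq l≡0 rewrite l≡0 = wrap-route {m′ = toℕ j} (begin
      suc (∣ toℕ i - toℕ j ∣ + toℕ j) ≡⟨ cong (λ m → suc (m + toℕ j)) (m≤n⇒∣n-m∣≡n∸m j≤i) ⟩
      suc (toℕ i ∸ toℕ j + toℕ j)     ≡⟨ cong suc (m∸n+n≡m j≤i) ⟩
      suc (toℕ i)                     ≡⟨ eq ⟩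
      2 * n                           ∎)
      where
      open ≡-Reasoning
      j≤i : toℕ j ≤ toℕ i
      j≤i = s≤s⁻¹ (subst (toℕ j <_) (sym eq) (toℕ<2n j))

    wrap-link′ : ∀ {i l : Fin (2 * n)} {d} (j : Fin (2 * n)) → toℕ i ≡ 0 → suc (toℕ l) ≡ 2 * n →
                 Route 0 n ∣ toℕ l - toℕ j ∣ d → Route 0 n ∣ toℕ i - toℕ j ∣ (suc d)
    wrap-link′ {i} {l} j i≡0 eq rewrite i≡0 = wrap-route {m = toℕ j} (begin
      suc (toℕ j + ∣ toℕ l - toℕ j ∣) ≡⟨ cong (λ m → suc (toℕ j + m)) (m≤n⇒∣n-m∣≡n∸m j≤l) ⟩
      suc (toℕ j + (toℕ l ∸ toℕ j))   ≡⟨ cong suc (m+[n∸m]≡n j≤l) ⟩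
      suc (toℕ l)                     ≡⟨ eq ⟩
      2 * n                           ∎)
      where
      open ≡-Reasoning
      j≤l : toℕ j ≤ toℕ l
      j≤l = s≤s⁻¹ (subst (toℕ j <_) (sym eq) (toℕ<2n j))

    stay : ∀ {c} (i : Fin (2 * n)) → Route c n ∣ toℕ i - toℕ i ∣ 0
    stay i = along (≤-reflexive (∣n-n∣≡0 (toℕ i)))

    H-route : ∀ {i j d} → Walk H i j d → Route 0 n ∣ toℕ i - toℕ j ∣ d
    H-route {i} [] = stay i
    H-route {j = j} (inj₁ (inj₁ (inj₁ eq)) ∷ w) =
      unwrapped-route j z≤n (inj₁ (inj₁ eq)) (H-route w)
    H-route {j = j} (inj₁ (inj₁ (inj₂ (eq , l≡0))) ∷ w) = wrap-link j eq l≡0 (H-route w)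
    H-route {j = j} (inj₁ (inj₂ (inj₁ eq)) ∷ w) =
      unwrapped-route j z≤n (inj₁ (inj₂ eq)) (H-route w)
    H-route {j = j} (inj₁ (inj₂ (inj₂ (eq , i≡0))) ∷ w) = wrap-link′ j i≡0 eq (H-route w)
    H-route {j = j} (inj₂ o ∷ w) = unwrapped-route j z≤n (inj₂ o) (H-route w)

    -- The two ends are specified by their numbers because `2 * n` does not reduce to a successor
    -- for a variable n. In the end `first` is supplied as the rotation of `last`.
    module Cut (last first : Fin (2 * n))
      (1+last≡2n : suc (toℕ last) ≡ 2 * n) (first≡0 : toℕ first ≡ 0) where

      P : Graph (2 * n)
      P = deleteLink H last first

      cut : ∀ {i j : Fin (2 * n)} → suc (toℕ i) ≡ 2 * n → toℕ j ≡ 0 → i ≡ last × j ≡ first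
      cut eq j≡0 =
        toℕ-injective (suc-injective (trans eq (sym 1+last≡2n))) ,
        toℕ-injective (trans j≡0 (sym first≡0))

      P-route : ∀ {i j d} → Walk P i j d → Route 2 n ∣ toℕ i - toℕ j ∣ d
      P-route {i} [] = stay i
      P-route {j = j} ((inj₁ (inj₁ (inj₁ eq)) , _) ∷ w) =
        unwrapped-route j ≤-refl (inj₁ (inj₁ eq)) (P-route w)
      P-route ((inj₁ (inj₁ (inj₂ (eq , l≡0))) , kept) ∷ _) = contradiction (inj₁ (cut eq l≡0)) kept
      P-route {j = j} ((inj₁ (inj₂ (inj₁ eq)) , _) ∷ w) =
        unwrapped-route j ≤-refl (inj₁ (inj₂ eq)) (P-route w)
      P-route ((inj₁ (inj₂ (inj₂ (eq , i≡0))) , kept) ∷ _) =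
        contradiction (inj₂ (Product.swap (cut eq i≡0))) kept
      P-route {j = j} ((inj₂ o , _) ∷ w) = unwrapped-route j ≤-refl (inj₂ o) (P-route w)

      -- The second bound reads j - i < 2n - 1; among the pairs with i < j only the ends of the cut
      -- link violate it.
      kept : ∀ {i j : Fin (2 * n)} → toℕ i < toℕ j → suc (toℕ j) < 2 * n + toℕ i →
             ¬ SameLink last first i j
      kept i<j _ (inj₁ (refl , refl)) = n≮0 (subst (toℕ last <_) first≡0 i<j)
      kept _ j<i+2n (inj₂ (refl , refl)) = <-irrefl 1+last≡2n
        (subst (suc (toℕ last) <_) (trans (cong (2 * n +_) first≡0) (+-identityʳ (2 * n))) j<i+2n)

      next-link : ∀ {i j : Fin (2 * n)} → suc (toℕ i) ≡ toℕ j → Adj P i j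
      next-link {i} {j} eq = inj₁ (inj₁ (inj₁ eq)) ,
        kept (≤-reflexive eq)
             (subst (λ j → suc j < 2 * n + toℕ i) eq (lin 1 (2≤n ⊞ 2≤n) (identity n (toℕ i))))
        where
        identity : ∀ n i → suc (2 + i) + (n + n) + 1 ≡ 2 * n + i + (2 + 2)
        identity = solve-∀

      opposite-link : ∀ {i j} → Opposite n i j → Adj P i j
      opposite-link {i} {j} eq = inj₂ (inj₁ eq) ,
        kept (subst (toℕ i <_) eq (m<m+n (toℕ i) (<-trans 0<1+n 2≤n)))
             (subst (λ j → suc j < 2 * n + toℕ i) eq (lin 0 2≤n (identity n (toℕ i))))
        where
        identity : ∀ n i → 2 + (i + n) + n + 0 ≡ 2 * n + i + 2
        identity = solve-∀

      vertex≤ : ∀ a b {j : Fin (2 * n)} → a + b ≡ toℕ j → ∃[ v ] toℕ {2 * n} v ≡ a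
      vertex≤ a b {j} eq = vertex (≤-<-trans (subst (a ≤_) eq (m≤m+n a b)) (toℕ<2n j))

      ahead : ∀ m {i j : Fin (2 * n)} → toℕ i + m ≡ toℕ j → Walk P i j m
      ahead zero {i} eq with refl ← toℕ-injective (trans (sym (+-identityʳ (toℕ i))) eq) = []
      ahead (suc m) {i} {j} eq =
        let v , v≡1+i = vertex≤ (suc (toℕ i)) m eq′
        in next-link (sym v≡1+i) ∷ ahead m (trans (cong (_+ m) v≡1+i) eq′)
        where
        eq′ : suc (toℕ i) + m ≡ toℕ j
        eq′ = trans (sym (+-suc (toℕ i) m)) eq

      shortcut⁻ : ∀ m t {i j : Fin (2 * n)} → toℕ i + m ≡ toℕ j → m + t ≡ n → Walk P i j (1 + t)
      shortcut⁻ m t {i} {j} i+m≡j m+t≡n with <-≤-connex (toℕ i + n) (2 * n)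
      ... | inj₁ i+n<2n = let v , v≡i+n = vertex i+n<2n in
        opposite-link (sym v≡i+n) ∷ reverse (ahead t (begin
          toℕ _ + t       ≡⟨ cong (_+ t) i+m≡j ⟨
          toℕ i + m + t   ≡⟨ +-assoc (toℕ i) m t ⟩
          toℕ i + (m + t) ≡⟨ cong (toℕ i +_) m+t≡n ⟩
          toℕ i + n       ≡⟨ v≡i+n ⟨
          toℕ v           ∎))
        where open ≡-Reasoning
      -- Now i ≥ n, so there is no vertex i + n. The chord is taken last instead: t steps back from
      -- i to j - n, then across to j.
      ... | inj₂ 2n≤i+n =
        let n≤i : n ≤ toℕ i
            n≤i = lin 0 2n≤i+n (identity n (toℕ i))
            o , n+o≡j = m≤n⇒∃[o]m+o≡n (≤-trans n≤i (subst (toℕ i ≤_) i+m≡j (m≤m+n (toℕ i) m)))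
            v , v≡o = vertex≤ o n (trans (+-comm o n) n+o≡j)
            v+n≡j = trans (cong (_+ n) v≡o) (trans (+-comm o n) n+o≡j)
        in subst (Walk P i j) (+-comm t 1)
          (reverse (ahead t (trans (cong (_+ t) v≡o) (+-cancelʳ-≡ m (o + t) (toℕ i) (shift o n+o≡j))))
           ++ link (opposite-link v+n≡j))
        where
        identity : ∀ n i → n + (i + n) + 0 ≡ i + 2 * n
        identity = solve-∀
        shift : ∀ o → n + o ≡ toℕ j → o + t + m ≡ toℕ i + m
        shift o n+o≡j = begin
          o + t + m   ≡⟨ rotated o t m ⟩
          m + t + o   ≡⟨ cong (_+ o) m+t≡n ⟩
          n + o       ≡⟨ n+o≡j ⟩
          toℕ j       ≡⟨ i+m≡j ⟨
          toℕ i + m   ∎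
          where
          open ≡-Reasoning
          rotated : ∀ o t m → o + t + m ≡ m + t + o
          rotated = solve-∀

      shortcut⁺ : ∀ t {i j : Fin (2 * n)} → toℕ i + (n + t) ≡ toℕ j → Walk P i j (1 + t)
      shortcut⁺ t {i} {j} eq =
        let v , v≡i+n = vertex≤ (toℕ i + n) t eq′
        in opposite-link (sym v≡i+n) ∷ ahead t (trans (cong (_+ t) v≡i+n) eq′)
        where
        eq′ = trans (+-assoc (toℕ i) n t) eq

      -- The chord from i leads to i + n, and the chord into j starts at j - n = i + t; between them
      -- lie s rim steps backwards.
      detour : ∀ t s {i j : Fin (2 * n)} → toℕ i + (n + t) ≡ toℕ j → t + s ≡ n → Walk P i j (2 + s)
      detour t s {i} {j} eq t+s≡n =
        let u , u≡i+n = vertex≤ (toℕ i + n) t eq′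
            v , v≡i+t = vertex≤ (toℕ i + t) n eq″
        in opposite-link (sym u≡i+n) ∷ subst (Walk P u j) (+-comm s 1)
             (reverse (ahead s (trans (cong (_+ s) v≡i+t)
                (trans (+-assoc (toℕ i) t s) (trans (cong (toℕ i +_) t+s≡n) (sym u≡i+n)))))
              ++ link (opposite-link (trans (cong (_+ n) v≡i+t) eq″)))
        where
        eq′ = trans (+-assoc (toℕ i) n t) eq
        eq″ = trans (+-assoc (toℕ i) t n) (trans (cong (toℕ i +_) (+-comm t n)) eq)

      P⇒H : ∀ {i j d} → Walk P i j d → Walk H i j d
      P⇒H = walk-map id proj₁

      -- `opposite` is the reversal j ↦ 2n - 1 - j of `Fin`, unlike the diametrical `Opposite`; here
      -- it counts the rim steps from j to `last`.
      around-walk : ∀ {i j} → Walk H i j (suc (toℕ i + toℕ (opposite j)))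
      around-walk {i} {j} = subst (Walk H i j) (+-suc (toℕ i) _)
        (P⇒H (reverse (ahead (toℕ i) (cong (_+ toℕ i) first≡0)))
         ++ inj₁ (inj₂ (inj₂ (1+last≡2n , first≡0)))
         ∷ P⇒H (reverse (ahead (toℕ (opposite j)) j+x≡last)))
        where
        j+x≡last : toℕ j + toℕ (opposite j) ≡ toℕ last
        j+x≡last = suc-injective (trans (cong (suc (toℕ j) +_) (opposite-prop j))
          (trans (m+[n∸m]≡n (toℕ<2n j)) (sym 1+last≡2n)))

  -- Distances and the terms of closeness.

  private variable
    G G′ : Graph N
    i j i′ j′ : Fin N

  0≤½^ : ∀ d → 0ℚ ℚ.≤ ½^ d
  0≤½^ zero    = ℚ.nonNegative⁻¹ 1ℚ
  0≤½^ (suc d) = subst (ℚ._≤ ½^ (suc d)) (ℚ.*-zeroʳ ½) (ℚ.*-monoˡ-≤-nonNeg ½ (0≤½^ d))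

  ½^-suc : ∀ d → ½^ (suc d) ℚ.≤ ½^ d
  ½^-suc d = subst (½^ (suc d) ℚ.≤_) (ℚ.*-identityˡ (½^ d))
    (ℚ.*-monoʳ-≤-nonNeg (½^ d) ⦃ ℚ.nonNegative (0≤½^ d) ⦄ ½≤1)
    where
    ½≤1 : ½ ℚ.≤ 1ℚ
    ½≤1 = toWitness {a? = ½ ℚ.≤? 1ℚ} _

  ½^-antitone : d ≤ e → ½^ e ℚ.≤ ½^ d
  ½^-antitone d≤e = go (≤⇒≤′ d≤e)
    where
    go : ∀ {e} → d ≤′ e → ½^ e ℚ.≤ ½^ d
    go (≤′-reflexive refl)  = ℚ.≤-refl
    go (≤′-step {e} d≤e) = ℚ.≤-trans (½^-suc e) (go d≤e)

  WalkUpTo : (G : Graph N) (i j : Fin N) → ℕ → Set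
  WalkUpTo G i j d = ∃[ e ] e ≤ d × Walk G i j e

  -- This compares two terms without computing either distance. Disconnected pairs fit in because
  -- their term 0 is the least possible one.
  2^-distance-mono : (∀ {d} → Walk G i j d → WalkUpTo G′ i′ j′ d) →
                     2^-distance G i j ℚ.≤ 2^-distance G′ i′ j′
  2^-distance-mono {G = G} {i} {j} {G′ = G′} {i′} {j′} transfer
    with distance? G i j | distance? G′ i′ j′
  ... | yes (_ , w , _) | yes (_ , _ , min) =
    let _ , e≤d , w′ = transfer w in ½^-antitone (≤-trans (min w′) e≤d)
  ... | yes (_ , w , _) | no ¬d =
    let e , _ , w′ = transfer w in contradiction (shortestWalk G′ e w′) ¬d
  ... | no _ | yes (d , _) = 0≤½^ d
  ... | no _ | no _ = ℚ.≤-refl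

  2^-distance-≡ : Walk G i j d → (∀ {e} → Walk G i j e → d ≤ e) → 2^-distance G i j ≡ ½^ d
  2^-distance-≡ {G = G} {i} {j} {d} w min with distance? G i j
  ... | yes (e , w′ , min′) = cong ½^_ (≤-antisym (min′ w) (min w′))
  ... | no ¬d = contradiction (d , w , λ {e} → min {e}) ¬d

  2^-distance-sym : (G : Graph N) → 2^-distance G i j ≡ 2^-distance G j i
  2^-distance-sym G = ℚ.≤-antisym (2^-distance-mono half) (2^-distance-mono half)
    where
    half : ∀ {i j d} → Walk G i j d → WalkUpTo G j i d
    half w = _ , ≤-refl , reverse w

  module Distances {n : ℕ} {2≤n : 2 ≤ n} {last first : Fin (2 * n)}
    (1+last≡2n : suc (toℕ last) ≡ 2 * n) (first≡0 : toℕ first ≡ 0) where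

    open Cut n 2≤n last first 1+last≡2n first≡0

    private
      H : Graph (2 * n)
      H = harary n 2≤n

    module _ {i j : Fin (2 * n)} (i≤j : toℕ i ≤ toℕ j) where

      -- 1 + x is the length of the walk from i to j through the link (first , last).
      x : ℕ
      x = toℕ i + toℕ (opposite j)

      m : ℕ
      m = toℕ j ∸ toℕ i

      i+m≡j : toℕ i + m ≡ toℕ j
      i+m≡j = m+[n∸m]≡n i≤j

      1+x+m≡2n : suc x + m ≡ 2 * n
      1+x+m≡2n = begin
        suc x + m ≡⟨ rearrange (toℕ i) m (toℕ (opposite j)) ⟩
        suc ((toℕ i + m) + toℕ (opposite j)) ≡⟨ cong (λ j′ → suc (j′ + toℕ (opposite j))) i+m≡j ⟩
        suc (toℕ j) + toℕ (opposite j) ≡⟨ cong (suc (toℕ j) +_) (opposite-prop j) ⟩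
        suc (toℕ j) + (2 * n ∸ suc (toℕ j)) ≡⟨ m+[n∸m]≡n (toℕ<n j) ⟩
        2 * n ∎
        where
        open ≡-Reasoning
        rearrange : ∀ i m o → suc (i + o) + m ≡ suc ((i + m) + o)
        rearrange = solve-∀

      i+[n+t]≡j : ∀ {t} → n + t ≡ m → toℕ i + (n + t) ≡ toℕ j
      i+[n+t]≡j n+t≡m = trans (cong (toℕ i +_) n+t≡m) i+m≡j

      1≤n : 1 ≤ n
      1≤n = ≤-trans (s≤s z≤n) 2≤n

      ∣i-j∣≡m : ∣ toℕ i - toℕ j ∣ ≡ m
      ∣i-j∣≡m = m≤n⇒∣m-n∣≡n∸m i≤j

      H-route′ : Walk H i j d → Route 0 n m d
      H-route′ w = subst (λ m → Route 0 n m _) ∣i-j∣≡m (H-route n 2≤n w)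

      P-route′ : Walk P i j d → Route 2 n m d
      P-route′ w = subst (λ m → Route 2 n m _) ∣i-j∣≡m (P-route w)

      -- With s = 1 + x and 2s > n the way through the cut link is never strictly best: for m ≤ n
      -- the rim walk of m ≤ s steps survives, and for m ≥ n one chord with m - n = n - s rim steps
      -- takes 1 + n - s ≤ s.
      cut-preserves : 1 + n ≤ 2 * suc x → Walk H i j d → WalkUpTo P i j d
      cut-preserves 1+n≤2s w with H-route′ w | ≤-total m n
      ... | along p    | _ = m , p , ahead m i+m≡j
      ... | across p _ | inj₁ m≤n with t , m+t≡n ← m≤n⇒∃[o]m+o≡n m≤n =
        1 + t , across-short m+t≡n p , shortcut⁻ m t i+m≡j m+t≡n
      ... | across _ p | inj₂ n≤m with t , n+t≡m ← m≤n⇒∃[o]m+o≡n n≤m =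
        1 + t , across-short n+t≡m p , shortcut⁺ t (i+[n+t]≡j n+t≡m)
      ... | around p   | inj₁ m≤n = m , around-along m≤n p , ahead m i+m≡j
      ... | around p   | inj₂ n≤m with t , n+t≡m ← m≤n⇒∃[o]m+o≡n n≤m =
        1 + t , around-across 1+x+m≡2n n+t≡m 1+n≤2s p , shortcut⁺ t (i+[n+t]≡j n+t≡m)

      distance-far : 1 + n ≤ 2 * suc x → 2^-distance H i j ≡ 2^-distance P i j
      distance-far 1+n≤2s = ℚ.≤-antisym (2^-distance-mono (cut-preserves 1+n≤2s))
        (2^-distance-mono λ w → _ , ≤-refl , P⇒H w)

      module _ (2s≤n : 2 * suc x ≤ n) where

        n+t≡m : ∃[ t ] n + t ≡ m
        n+t≡m = m≤n⇒∃[o]m+o≡n (far-apart 1+x+m≡2n (≤-trans (m≤m+n (suc x) _) 2s≤n))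

        H-distance-near : 2^-distance H i j ≡ ½^ suc x
        H-distance-near = 2^-distance-≡ around-walk λ w →
          route-bound 1≤n 1+x+m≡2n z≤n (m≤n⇒m≤1+n 2s≤n) (H-route′ w)

        P-distance-middle : 2 * suc x ≡ n → 2^-distance P i j ≡ ½^ (2 + x)
        P-distance-middle 2s≡n = let t , n+t≡m = n+t≡m in
          2^-distance-≡
            (subst (λ s → Walk P i j (1 + s))
              -- From t + s = n = 2s it follows that t = s, so the chord route takes 1 + s steps,
              -- one fewer than the detour.
              (+-cancelʳ-≡ (suc x) t (suc x) (trans (complement 1+x+m≡2n n+t≡m)
                (trans (sym 2s≡n) (cong (suc x +_) (+-identityʳ (suc x))))))
              (shortcut⁺ t (i+[n+t]≡j n+t≡m)))
            λ w → route-bound 1≤n 1+x+m≡2n (s≤s z≤n) (s≤s (≤-reflexive 2s≡n)) (P-route′ w)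

        P-distance-near : 2 * suc x < n → 2^-distance P i j ≡ ½^ (3 + x)
        P-distance-near 2s<n = let t , n+t≡m = n+t≡m in
          2^-distance-≡ (detour t (suc x) (i+[n+t]≡j n+t≡m) (complement 1+x+m≡2n n+t≡m))
            λ w → route-bound 1≤n 1+x+m≡2n ≤-refl (s≤s 2s<n) (P-route′ w)

-- Summing the losses over all pairs.

module _ where
  open import Algebra.Properties.CommutativeMonoid.Sum ℚ.+-0-commutativeMonoid
    using (sum-cong-≗; ∑-distrib-+; sum-permute; ∑-comm; sum-replicate-zero)
  open import Data.Bool.Base using (true; false; if_then_else_)
  open import Data.Fin.Permutation as Perm
    using (Permutation′; _⟨$⟩ʳ_; _⟨$⟩ˡ_; permutation; inverseˡ; inverseʳ)
  open import Data.Fin.Relation.Unary.Top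
    using (view; ‵fromℕ; ‵inject₁; ‵inj₁; view-fromℕ; view-inject₁)
  import Data.Integer.Base as ℤ
  import Data.Integer.Properties as ℤ
  open import Data.Nat.Base using (_∸_)
  import Data.Nat.Coprimality as Coprime
  open import Data.Rational.Base hiding (_/_)
  open import Data.Rational.Properties hiding (_≟_)
  open import Data.Rational.Solver using (module +-*-Solver)
  open import Data.Sum.Base using (swap)
  open +-*-Solver using (solve; _:+_; _:*_; _:-_; _:=_; con)

  private variable
    N d : ℕ

  Σ-cong : {f g : Fin N → ℚ} → (∀ i → f i ≡ g i) → Σℚ f ≡ Σℚ g
  Σ-cong {N} = sum-cong-≗ {N}

  Σ-permute : (f : Fin N → ℚ) (π : Permutation′ N) → Σℚ f ≡ Σℚ (λ i → f (π ⟨$⟩ʳ i))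
  Σ-permute {N} = sum-permute {N} {N}

  ΣΣ-cong : {f g : Fin N → Fin N → ℚ} → (∀ i j → f i j ≡ g i j) →
            Σℚ (λ i → Σℚ (f i)) ≡ Σℚ (λ i → Σℚ (g i))
  ΣΣ-cong {N} f≗g = Σ-cong {N} λ i → Σ-cong {N} (f≗g i)

  ΣΣ-distrib-+ : (f g : Fin N → Fin N → ℚ) →
                 Σℚ (λ i → Σℚ (λ j → f i j + g i j)) ≡ Σℚ (λ i → Σℚ (f i)) + Σℚ (λ i → Σℚ (g i))
  ΣΣ-distrib-+ {N} f g = trans (Σ-cong {N} λ i → ∑-distrib-+ (f i) (g i))
                           (∑-distrib-+ (λ i → Σℚ (f i)) (λ i → Σℚ (g i)))

  -- The sum of h over 1, ..., e. Iterated twice up to K it gives h (e) the weight K + 1 - e, which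
  -- for e = K - x is 1 + x = s, the number of pairs with that s.
  cumulative : (ℕ → ℚ) → ℕ → ℚ
  cumulative h zero    = 0ℚ
  cumulative h (suc e) = h (suc e) + cumulative h e

  module _ {h : ℕ → ℚ} (h0≡0 : h 0 ≡ 0ℚ) where

    cumulative-step : ∀ K a → h (K ∸ a) + cumulative h (K ∸ suc a) ≡ cumulative h (K ∸ a)
    cumulative-step zero a rewrite ℕ.0∸n≡0 a = trans (+-identityʳ (h 0)) h0≡0
    cumulative-step (suc K) zero    = refl
    cumulative-step (suc K) (suc a) = cumulative-step K a

    -- Truncated subtraction ends the sum by itself: once a + r ≥ K the argument is 0, where h
    -- vanishes.
    Σ-cumulative : ∀ N K a → K ℕ.≤ a ℕ.+ N →
                   Σℚ {N} (λ r → h (K ∸ (a ℕ.+ toℕ r))) ≡ cumulative h (K ∸ a)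
    Σ-cumulative zero K a K≤a =
      sym (cong (cumulative h) (ℕ.m≤n⇒m∸n≡0 (subst (K ℕ.≤_) (ℕ.+-identityʳ a) K≤a)))
    Σ-cumulative (suc N) K a K≤a+N = begin
      h (K ∸ (a ℕ.+ 0)) + Σℚ {N} (λ r → h (K ∸ (a ℕ.+ suc (toℕ r))))
        ≡⟨ cong₂ _+_ (cong (λ b → h (K ∸ b)) (ℕ.+-identityʳ a))
                     (Σ-cong {N} λ r → cong (λ b → h (K ∸ b)) (ℕ.+-suc a (toℕ r))) ⟩
      h (K ∸ a) + Σℚ {N} (λ r → h (K ∸ (suc a ℕ.+ toℕ r)))
        ≡⟨ cong (h (K ∸ a) +_) (Σ-cumulative N K (suc a) (subst (K ℕ.≤_) (ℕ.+-suc a N) K≤a+N)) ⟩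
      h (K ∸ a) + cumulative h (K ∸ suc a)
        ≡⟨ cumulative-step K a ⟩
      cumulative h (K ∸ a) ∎
      where open ≡-Reasoning

  ΣΣ-cumulative : ∀ {h} → h 0 ≡ 0ℚ → ∀ N K → K ℕ.≤ N →
                  Σℚ {N} (λ i → Σℚ {N} (λ r → h (K ∸ (toℕ i ℕ.+ toℕ r)))) ≡
                  cumulative (cumulative h) K
  ΣΣ-cumulative {h} h0≡0 N K K≤N =
    trans (Σ-cong {N} λ i → Σ-cumulative {h} h0≡0 N K (toℕ i) (ℕ.≤-trans K≤N (ℕ.m≤n+m N (toℕ i))))
          (Σ-cumulative {cumulative h} refl N K 0 K≤N)

  module _ (G G′ : Graph N) {h : ℕ → ℚ} (h0≡0 : h 0 ≡ 0ℚ) {K : ℕ} (K<N : K ℕ.< N)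
    (gap : ∀ {i j} → toℕ i ℕ.≤ toℕ j →
           2^-distance G i j ≡ 2^-distance G′ i j + h (K ∸ (toℕ i ℕ.+ toℕ (opposite j))))
    (sym-G : ∀ i j → 2^-distance G i j ≡ 2^-distance G j i)
    (sym-G′ : ∀ i j → 2^-distance G′ i j ≡ 2^-distance G′ j i)
    where

    private
      g : Fin N → Fin N → ℚ
      g i j = h (K ∸ (toℕ i ℕ.+ toℕ (opposite j)))

      S : ℚ
      S = cumulative (cumulative h) K

    -- On and below the diagonal the two coordinates add up to at least N - 1 ≥ K. Hence
    -- `g i j + g j i` is the loss for either order of i and j and is 0 on the diagonal.
    g≡0 : ∀ {i j} → toℕ i ℕ.≤ toℕ j → g j i ≡ 0ℚ
    g≡0 {i} {j} i≤j = trans (cong h (ℕ.m≤n⇒m∸n≡0 (ℕ.s≤s⁻¹ (begin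
      suc K                                ≤⟨ K<N ⟩
      N                                    ≡⟨ ℕ.m+[n∸m]≡n (toℕ<n i) ⟨
      suc (toℕ i) ℕ.+ (N ∸ suc (toℕ i))    ≡⟨ cong (suc (toℕ i) ℕ.+_) (opposite-prop i) ⟨
      suc (toℕ i ℕ.+ toℕ (opposite i))     ≤⟨ ℕ.s≤s (ℕ.+-monoˡ-≤ _ i≤j) ⟩
      suc (toℕ j ℕ.+ toℕ (opposite i))     ∎)))) h0≡0
      where open ℕ.≤-Reasoning

    gap-sym : ∀ i j → 2^-distance G i j ≡ 2^-distance G′ i j + (g i j + g j i)
    gap-sym i j with ℕ.≤-total (toℕ i) (toℕ j)
    ... | inj₁ i≤j = trans (gap i≤j) (cong (2^-distance G′ i j +_)
      (sym (trans (cong (g i j +_) (g≡0 i≤j)) (+-identityʳ (g i j)))))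
    ... | inj₂ j≤i = trans (sym-G i j) (trans (gap j≤i) (cong₂ _+_ (sym-G′ j i)
      (sym (trans (cong (_+ g j i) (g≡0 j≤i)) (+-identityˡ (g j i))))))

    offDiagonal-gap : ∀ i j → offDiagonal (2^-distance G) i j ≡
                              offDiagonal (2^-distance G′) i j + (g i j + g j i)
    offDiagonal-gap i j with i ≟ j
    ... | yes refl = sym (trans (+-identityˡ _) (cong₂ _+_ (g≡0 {i} ℕ.≤-refl) (g≡0 {i} ℕ.≤-refl)))
    ... | no _     = gap-sym i j

    ΣΣg≡S : Σℚ (λ i → Σℚ (λ j → g i j)) ≡ S
    -- Summing over r = `opposite j` instead of j makes the summand a function of i + r.
    ΣΣg≡S = trans (Σ-cong {N} λ i → sym (Σ-permute {N} (f i) Perm.reverse))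
                  (ΣΣ-cumulative h0≡0 N K (ℕ.<⇒≤ K<N))
      where
      f : Fin N → Fin N → ℚ
      f i r = h (K ∸ (toℕ i ℕ.+ toℕ r))

    closeness-gap : closeness G ≡ closeness G′ + (S + S)
    closeness-gap = begin
      closeness G ≡⟨ ΣΣ-cong offDiagonal-gap ⟩
      Σℚ (λ i → Σℚ (λ j → c i j + (g i j + g j i)))
        ≡⟨ ΣΣ-distrib-+ c (λ i j → g i j + g j i) ⟩
      closeness G′ + Σℚ (λ i → Σℚ (λ j → g i j + g j i))
        ≡⟨ cong (closeness G′ +_) (ΣΣ-distrib-+ g (λ i j → g j i)) ⟩
      closeness G′ + (Σℚ (λ i → Σℚ (g i)) + Σℚ (λ i → Σℚ (λ j → g j i)))
        ≡⟨ cong (closeness G′ +_) (cong₂ _+_ ΣΣg≡S (trans (∑-comm (λ i j → g j i)) ΣΣg≡S)) ⟩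
      closeness G′ + (S + S) ∎
      where
      open ≡-Reasoning
      c : Fin N → Fin N → ℚ
      c = offDiagonal (2^-distance G′)

  -- Closed forms for the loss at a rim link.

  fromℕ-mkℚ : ∀ m → fromℕ m ≡ mkℚ (ℤ.+ m) 0 (Coprime.sym (Coprime.1-coprimeTo m))
  fromℕ-mkℚ m = normalize-coprime (Coprime.sym (Coprime.1-coprimeTo m))

  fromℕ-+ : ∀ a b → fromℕ (a ℕ.+ b) ≡ fromℕ a + fromℕ b
  fromℕ-+ a b = trans
    (/-cong (trans (ℤ.pos-+ a b)
                   (sym (cong₂ ℤ._+_ (ℤ.*-identityʳ (ℤ.+ a)) (ℤ.*-identityʳ (ℤ.+ b))))) refl)
    (sym (cong₂ _+_ (fromℕ-mkℚ a) (fromℕ-mkℚ b)))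

  fromℕ-mono-≤ : ∀ {a b} → a ℕ.≤ b → fromℕ a ≤ fromℕ b
  fromℕ-mono-≤ {a} {b} a≤b = subst₂ _≤_ (sym (fromℕ-mkℚ a)) (sym (fromℕ-mkℚ b))
    (*≤* (ℤ.*-monoʳ-≤-nonNeg (ℤ.+ 1) (ℤ.+≤+ a≤b)))

  3/4 3/2 2ℚ : ℚ
  3/4 = ℤ.+ 3 ℚ./ 4
  3/2 = ℤ.+ 3 ℚ./ 2
  2ℚ  = ℤ.+ 2 ℚ./ 1

  2^_ : ℕ → ℚ
  2^ zero  = 1ℚ
  2^ suc e = 2ℚ * 2^ e
  infix 8 2^_

  ½^-cancel : ∀ a e → ½^ (a ℕ.+ e) * 2^ e ≡ ½^ a
  ½^-cancel a zero    = trans (*-identityʳ _) (cong ½^_ (ℕ.+-identityʳ a))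
  ½^-cancel a (suc e) rewrite ℕ.+-suc a e =
    trans (solve 2 (λ x y → (con ½ :* x) :* (con 2ℚ :* y) := x :* y) refl (½^ (a ℕ.+ e)) (2^ e))
          (½^-cancel a e)

  -- With q = ½^ K and e = K - x, the amount ½^ dH - ½^ dP lost by a pair at distance dH = s = 1 + x,
  -- for n = 2K + 1 and n = 2K.  Counting from e = 0, where nothing is lost, makes the double sum
  -- over pairs telescope.
  module _ (q : ℚ) where

    oddLoss evenLoss : ℕ → ℚ
    oddLoss zero    = 0ℚ
    oddLoss (suc e) = 3/4 * (q * 2^ e)
    evenLoss zero          = 0ℚ
    evenLoss (suc zero)    = ½ * q
    evenLoss (suc (suc e)) = 3/4 * (q * 2^ suc e)

    private
      Σ-odd : ∀ e → cumulative oddLoss e ≡ 3/4 * (q * (2^ e - 1ℚ))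
      Σ-odd zero    = solve 1 (λ q → con 0ℚ := con 3/4 :* (q :* (con 1ℚ :- con 1ℚ))) refl q
      Σ-odd (suc e) = trans (cong (oddLoss (suc e) +_) (Σ-odd e))
        (solve 2 (λ q p → con 3/4 :* (q :* p) :+ con 3/4 :* (q :* (p :- con 1ℚ))
          := con 3/4 :* (q :* (con 2ℚ :* p :- con 1ℚ))) refl q (2^ e))

      Σ-even : ∀ e → cumulative evenLoss (suc e) ≡ q * (3/4 * 2^ suc e - 1ℚ)
      Σ-even zero    =
        solve 1 (λ q → con ½ :* q :+ con 0ℚ := q :* (con 3/4 :* (con 2ℚ :* con 1ℚ) :- con 1ℚ)) refl q
      Σ-even (suc e) = trans (cong (evenLoss (suc (suc e)) +_) (Σ-even e))
        (solve 2 (λ q p → con 3/4 :* (q :* (con 2ℚ :* p)) :+ q :* (con 3/4 :* (con 2ℚ :* p) :- con 1ℚ)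
          := q :* (con 3/4 :* (con 2ℚ :* (con 2ℚ :* p)) :- con 1ℚ)) refl q (2^ e))

    -- q stays fixed while e grows; only at e = k does `q * 2^ e` become 1. Doubled for ordered
    -- pairs, the value there is 3 - 3 (k + 2) q / 2, and `ΣΣ-even` gives 3 - (2k + 3) q.
    ΣΣ-odd : ∀ e → cumulative (cumulative oddLoss) e ≡ 3/2 * (q * 2^ e - q) - 3/4 * (q * fromℕ e)
    ΣΣ-odd zero    =
      solve 1 (λ q → con 0ℚ := con 3/2 :* (q :* con 1ℚ :- q) :- con 3/4 :* (q :* con 0ℚ)) refl q
    ΣΣ-odd (suc e) rewrite fromℕ-+ 1 e = trans (cong₂ _+_ (Σ-odd (suc e)) (ΣΣ-odd e))
      (solve 3 (λ q p f → con 3/4 :* (q :* (con 2ℚ :* p :- con 1ℚ))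
          :+ (con 3/2 :* (q :* p :- q) :- con 3/4 :* (q :* f))
        := con 3/2 :* (q :* (con 2ℚ :* p) :- q) :- con 3/4 :* (q :* (con 1ℚ :+ f))) refl q (2^ e) (fromℕ e))

    ΣΣ-even : ∀ e → cumulative (cumulative evenLoss) e ≡ 3/2 * (q * 2^ e - q) - q * fromℕ e
    ΣΣ-even zero    = solve 1 (λ q → con 0ℚ := con 3/2 :* (q :* con 1ℚ :- q) :- q :* con 0ℚ) refl q
    ΣΣ-even (suc e) rewrite fromℕ-+ 1 e = trans (cong₂ _+_ (Σ-even e) (ΣΣ-even e))
      (solve 3 (λ q p f → q :* (con 3/4 :* (con 2ℚ :* p) :- con 1ℚ)
          :+ (con 3/2 :* (q :* p :- q) :- q :* f)
        := con 3/2 :* (q :* (con 2ℚ :* p) :- q) :- q :* (con 1ℚ :+ f)) refl q (2^ e) (fromℕ e))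

  fromℕ[2k+3] : ∀ k → fromℕ (2 ℕ.* k ℕ.+ 3) ≡ fromℕ k + (fromℕ k + 0ℚ) + fromℕ 3
  fromℕ[2k+3] k rewrite fromℕ-+ (2 ℕ.* k) 3 | fromℕ-+ k (k ℕ.+ 0) | fromℕ-+ k 0 = refl

  fromℕ[3[k+2]] : ∀ k → fromℕ (3 ℕ.* (k ℕ.+ 2)) ≡ fromℕ 3 * (fromℕ k + fromℕ 2)
  fromℕ[3[k+2]] k
    rewrite fromℕ-+ (k ℕ.+ 2) (k ℕ.+ 2 ℕ.+ (k ℕ.+ 2 ℕ.+ 0))
          | fromℕ-+ (k ℕ.+ 2) (k ℕ.+ 2 ℕ.+ 0)
          | fromℕ-+ (k ℕ.+ 2) 0
          | fromℕ-+ k 2 =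
    solve 1 (λ f → f :+ con 2ℚ :+ (f :+ con 2ℚ :+ (f :+ con 2ℚ :+ con 0ℚ))
      := con (fromℕ 3) :* (f :+ con 2ℚ)) refl (fromℕ k)

  ½^k*2^k≡1 : ∀ k → ½^ k * 2^ k ≡ 1ℚ
  ½^k*2^k≡1 = ½^-cancel 0

  ∸-split : ∀ K x {e} → K ∸ x ≡ suc e → K ≡ suc x ℕ.+ e
  ∸-split K x {e} eq = begin
    K                ≡⟨ ℕ.m+[n∸m]≡n {x} {K} (ℕ.<⇒≤ (ℕ.m∸n≢0⇒n<m K∸x≢0)) ⟨
    x ℕ.+ (K ∸ x)    ≡⟨ cong (x ℕ.+_) eq ⟩
    x ℕ.+ suc e      ≡⟨ ℕ.+-suc x e ⟩
    suc x ℕ.+ e      ∎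
    where
    open ≡-Reasoning
    K∸x≢0 : K ∸ x ≢ 0
    K∸x≢0 eq′ = ℕ.1+n≢0 (trans (sym eq) eq′)

  module _ (x : ℕ) {dH dP : ℚ} where

    -- For odd n the case 2s = n is absent: `k ∸ x` is 0 exactly if 2s > n and positive exactly if
    -- 2s < n.
    odd-gap : ∀ k → let n = 2 ℕ.* k ℕ.+ 1 in
      (n ℕ.< 2 ℕ.* suc x → dH ≡ dP) →
      (2 ℕ.* suc x ℕ.≤ n → dH ≡ ½^ suc x) →
      (2 ℕ.* suc x ℕ.< n → dP ≡ ½^ (3 ℕ.+ x)) →
      dH ≡ dP + oddLoss (½^ k) (k ∸ x)
    odd-gap k far near-H near-P with k ∸ x in eq
    ... | zero = trans (far (lin 0 (k≤x ⊞ k≤x) (identity k x))) (sym (+-identityʳ dP))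
      where
      k≤x : k ℕ.≤ x
      k≤x = ℕ.m∸n≡0⇒m≤n eq
      identity : ∀ k x → suc (2 ℕ.* k ℕ.+ 1) ℕ.+ (x ℕ.+ x) ℕ.+ 0 ≡ 2 ℕ.* suc x ℕ.+ (k ℕ.+ k)
      identity = solve-∀
    ... | suc e rewrite ∸-split k x eq = begin
      dH ≡⟨ near-H (ℕ.<⇒≤ 2s<n) ⟩
      ½^ suc x
        ≡⟨ solve 1 (λ y → y := con ½ :* (con ½ :* y) :+ con 3/4 :* y) refl (½^ suc x) ⟩
      ½^ (3 ℕ.+ x) + 3/4 * ½^ suc x
        ≡⟨ cong₂ (λ y z → y + 3/4 * z) (near-P 2s<n) (½^-cancel (suc x) e) ⟨
      dP + 3/4 * (½^ (suc x ℕ.+ e) * 2^ e) ∎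
      where
      open ≡-Reasoning
      identity : ∀ x e → suc (2 ℕ.* suc x) ℕ.+ 0 ℕ.+ 2 ℕ.* e ≡ 2 ℕ.* (suc x ℕ.+ e) ℕ.+ 1 ℕ.+ 0
      identity = solve-∀
      2s<n : 2 ℕ.* suc x ℕ.< 2 ℕ.* (suc x ℕ.+ e) ℕ.+ 1
      2s<n = lin (2 ℕ.* e) (ℕ.z≤n {0}) (identity x e)

    -- For n = 2k the value 1 of `k ∸ x` singles out s = k, that is 2s = n, where one extra step
    -- costs half of ½^ k. Smaller and larger values mean 2s > n and 2s < n.
    even-gap : ∀ k → let n = 2 ℕ.* k in
      (n ℕ.< 2 ℕ.* suc x → dH ≡ dP) →
      (2 ℕ.* suc x ℕ.≤ n → dH ≡ ½^ suc x) →
      (2 ℕ.* suc x ℕ.< n → dP ≡ ½^ (3 ℕ.+ x)) →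
      (2 ℕ.* suc x ≡ n → dP ≡ ½^ (2 ℕ.+ x)) →
      dH ≡ dP + evenLoss (½^ k) (k ∸ x)
    even-gap k far near-H near-P middle-P with k ∸ x in eq
    ... | zero = trans (far (lin 1 (k≤x ⊞ k≤x) (identity k x))) (sym (+-identityʳ dP))
      where
      k≤x : k ℕ.≤ x
      k≤x = ℕ.m∸n≡0⇒m≤n eq
      identity : ∀ k x → suc (2 ℕ.* k) ℕ.+ (x ℕ.+ x) ℕ.+ 1 ≡ 2 ℕ.* suc x ℕ.+ (k ℕ.+ k)
      identity = solve-∀
    ... | suc zero rewrite trans (∸-split k x eq) (ℕ.+-identityʳ (suc x)) = begin
      dH ≡⟨ near-H ℕ.≤-refl ⟩
      ½^ suc x
        ≡⟨ solve 1 (λ y → y := con ½ :* y :+ con ½ :* y) refl (½^ suc x) ⟩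
      ½^ (2 ℕ.+ x) + ½ * ½^ suc x
        ≡⟨ cong (_+ ½ * ½^ suc x) (middle-P refl) ⟨
      dP + ½ * ½^ suc x ∎
      where open ≡-Reasoning
    ... | suc (suc e) rewrite ∸-split k x eq = begin
      dH ≡⟨ near-H (ℕ.<⇒≤ 2s<n) ⟩
      ½^ suc x
        ≡⟨ solve 1 (λ y → y := con ½ :* (con ½ :* y) :+ con 3/4 :* y) refl (½^ suc x) ⟩
      ½^ (3 ℕ.+ x) + 3/4 * ½^ suc x
        ≡⟨ cong₂ (λ y z → y + 3/4 * z) (near-P 2s<n) (½^-cancel (suc x) (suc e)) ⟨
      dP + 3/4 * (½^ (suc x ℕ.+ suc e) * 2^ suc e) ∎
      where
      open ≡-Reasoning
      identity : ∀ x e → suc (2 ℕ.* suc x) ℕ.+ 0 ℕ.+ (1 ℕ.+ 2 ℕ.* e) ≡ 2 ℕ.* (suc x ℕ.+ suc e) ℕ.+ 0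
      identity = solve-∀
      2s<n : 2 ℕ.* suc x ℕ.< 2 ℕ.* (suc x ℕ.+ suc e)
      2s<n = lin (1 ℕ.+ 2 ℕ.* e) (ℕ.z≤n {0}) (identity x e)

  odd-value : ∀ k {cH cP} → let S = cumulative (cumulative (oddLoss (½^ k))) k in
    cH ≡ cP + (S + S) → cP ≡ cH - fromℕ 3 + fromℕ (3 ℕ.* (k ℕ.+ 2)) * ½^ (1 ℕ.+ k)
  odd-value k {cP = cP} refl rewrite ΣΣ-odd (½^ k) k | ½^k*2^k≡1 k | fromℕ[3[k+2]] k =
    solve 3 (λ c q f →
      let S = con 3/2 :* (con 1ℚ :- q) :- con 3/4 :* (q :* f)
      in c := c :+ (S :+ S) :- con (fromℕ 3)
              :+ con (fromℕ 3) :* (f :+ con (fromℕ 2)) :* (con ½ :* q))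
    refl cP (½^ k) (fromℕ k)

  even-value : ∀ k {cH cP} → let S = cumulative (cumulative (evenLoss (½^ k))) k in
    cH ≡ cP + (S + S) → cP ≡ cH - fromℕ 3 + fromℕ (2 ℕ.* k ℕ.+ 3) * ½^ k
  even-value k {cP = cP} refl rewrite ΣΣ-even (½^ k) k | ½^k*2^k≡1 k | fromℕ[2k+3] k =
    solve 3 (λ c q f →
      let S = con 3/2 :* (con 1ℚ :- q) :- q :* f
      in c := c :+ (S :+ S) :- con (fromℕ 3) :+ (f :+ (f :+ con 0ℚ) :+ con (fromℕ 3)) :* q)
    refl cP (½^ k) (fromℕ k)

  module _ {k : ℕ} (1≤k : 1 ℕ.≤ k) where

    module _ {last first : Fin (2 ℕ.* (2 ℕ.* k ℕ.+ 1))}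
      (1+last≡2n : suc (toℕ last) ≡ 2 ℕ.* (2 ℕ.* k ℕ.+ 1)) (first≡0 : toℕ first ≡ 0) where

      private
        H P : Graph (2 ℕ.* (2 ℕ.* k ℕ.+ 1))
        H = harary (2 ℕ.* k ℕ.+ 1) (2≤2k+1 1≤k)
        P = deleteLink H last first

      open Distances {2≤n = 2≤2k+1 1≤k} 1+last≡2n first≡0

      odd-rim : closeness P ≡ closeness H - fromℕ 3 + fromℕ (3 ℕ.* (k ℕ.+ 2)) * ½^ (1 ℕ.+ k)
      odd-rim = odd-value k {closeness H} {closeness P} (closeness-gap H P {oddLoss (½^ k)} refl
        (lin (1 ℕ.+ 3 ℕ.* k) (ℕ.z≤n {0}) (identity k))
        (λ {i} {j} i≤j → odd-gap (toℕ i ℕ.+ toℕ (opposite j)) k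
          (distance-far i≤j) (H-distance-near i≤j) λ 2s<n → P-distance-near i≤j (ℕ.<⇒≤ 2s<n) 2s<n)
        (λ i j → 2^-distance-sym H) (λ i j → 2^-distance-sym P))
        where
        identity : ∀ k → suc k ℕ.+ 0 ℕ.+ (1 ℕ.+ 3 ℕ.* k) ≡ 2 ℕ.* (2 ℕ.* k ℕ.+ 1) ℕ.+ 0
        identity = solve-∀

    module _ {last first : Fin (2 ℕ.* (2 ℕ.* k))}
      (1+last≡2n : suc (toℕ last) ≡ 2 ℕ.* (2 ℕ.* k)) (first≡0 : toℕ first ≡ 0) where

      private
        H P : Graph (2 ℕ.* (2 ℕ.* k))
        H = harary (2 ℕ.* k) (2≤2k 1≤k)
        P = deleteLink H last first

      open Distances {2≤n = 2≤2k 1≤k} 1+last≡2n first≡0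

      even-rim : closeness P ≡ closeness H - fromℕ 3 + fromℕ (2 ℕ.* k ℕ.+ 3) * ½^ k
      even-rim = even-value k {closeness H} {closeness P} (closeness-gap H P {evenLoss (½^ k)} refl
        (lin 2 (1≤k ⊞ 1≤k ⊞ 1≤k) (identity k))
        (λ {i} {j} i≤j → even-gap (toℕ i ℕ.+ toℕ (opposite j)) k
          (distance-far i≤j) (H-distance-near i≤j) (λ 2s<n → P-distance-near i≤j (ℕ.<⇒≤ 2s<n) 2s<n)
          λ 2s≡n → P-distance-middle i≤j (ℕ.≤-reflexive 2s≡n) 2s≡n)
        (λ i j → 2^-distance-sym H) (λ i j → 2^-distance-sym P))
        where
        identity : ∀ k → suc k ℕ.+ (k ℕ.+ k ℕ.+ k) ℕ.+ 2 ≡ 2 ℕ.* (2 ℕ.* k) ℕ.+ (1 ℕ.+ 1 ℕ.+ 1)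
        identity = solve-∀

  -- Comparing closeness: bijective homomorphisms, and links on 4-cycles.

  Σ-mono-≤ : {f g : Fin N → ℚ} → (∀ i → f i ≤ g i) → Σℚ f ≤ Σℚ g
  Σ-mono-≤ {zero}  f≤g = ≤-refl
  Σ-mono-≤ {suc N} f≤g = +-mono-≤ (f≤g zero) (Σ-mono-≤ {N} (f≤g ∘ suc))

  -- Images of walks are walks of the same length, so distances cannot grow; injectivity of π keeps
  -- distinct vertices distinct.
  closeness-mono : ∀ (G G′ : Graph N) (π : Permutation′ N) →
    (∀ {i j} → Adj G i j → Adj G′ (π ⟨$⟩ʳ i) (π ⟨$⟩ʳ j)) → closeness G ≤ closeness G′
  closeness-mono {N} G G′ π hom = begin
    closeness G
      ≤⟨ Σ-mono-≤ {N} (λ i → Σ-mono-≤ {N} (entry i)) ⟩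
    Σℚ (λ i → Σℚ (λ j → c (π ⟨$⟩ʳ i) (π ⟨$⟩ʳ j)))
      ≡⟨ Σ-cong {N} (λ i → Σ-permute {N} (c (π ⟨$⟩ʳ i)) π) ⟨
    Σℚ (λ i → Σℚ (c (π ⟨$⟩ʳ i)))
      ≡⟨ Σ-permute {N} (λ i → Σℚ (c i)) π ⟨
    closeness G′ ∎
    where
    open ≤-Reasoning
    c : Fin N → Fin N → ℚ
    c = offDiagonal (2^-distance G′)
    entry : ∀ i j → offDiagonal (2^-distance G) i j ≤ c (π ⟨$⟩ʳ i) (π ⟨$⟩ʳ j)
    entry i j with i ≟ j | (π ⟨$⟩ʳ i) ≟ (π ⟨$⟩ʳ j)
    ... | yes _    | yes _  = ≤-refl
    ... | yes refl | no ¬eq = contradiction refl ¬eq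
    ... | no i≢j   | yes eq =
      contradiction (trans (sym (inverseˡ π)) (trans (cong (π ⟨$⟩ˡ_) eq) (inverseˡ π))) i≢j
    ... | no _     | no _   = 2^-distance-mono λ w → _ , ℕ.≤-refl , walk-map (π ⟨$⟩ʳ_) hom w

  pick : Fin N → ℚ → Fin N → ℚ
  pick r q i = if does (r ≟ i) then q else 0ℚ

  Σ-pick : (r : Fin N) (q : ℚ) → Σℚ (pick r q) ≡ q
  Σ-pick {suc N} zero    q = trans (cong (q +_) (sum-replicate-zero N)) (+-identityʳ q)
  Σ-pick {suc N} (suc r) q = trans (+-identityˡ _) (Σ-pick r q)

  pick-self : (r : Fin N) {q : ℚ} → pick r q r ≡ q
  pick-self r {q} = cong (if_then q else 0ℚ) (dec-true (r ≟ r) refl)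

  pick-nonNeg : (r : Fin N) {q : ℚ} → 0ℚ ≤ q → ∀ i → 0ℚ ≤ pick r q i
  pick-nonNeg r 0≤q i with does (r ≟ i)
  ... | true  = 0≤q
  ... | false = ≤-refl

  ΣΣ-pick : (r s : Fin N) (q : ℚ) → Σℚ (λ i → Σℚ (λ j → pick r (pick s q j) i)) ≡ q
  ΣΣ-pick {N} r s q = trans (∑-comm {N} {N} λ i j → pick r (pick s q j) i)
    (trans (Σ-cong {N} λ j → Σ-pick r (pick s q j)) (Σ-pick s q))

  module _ (G : Graph N) {r s : Fin N} (rs : Adj G r s) where

    private
      G⁻ : Graph N
      G⁻ = deleteLink G r s

    -- Every other link at either end of (r , s) lies on a 4-cycle through (r , s).
    Bypassed : Set
    Bypassed = ∀ {i j l} → SameLink r s i j → Adj G i l → l ≢ j →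
               ∃[ l′ ] Adj G l l′ × Adj G l′ j × l′ ≢ i

    sameLink? : ∀ i j → Dec (SameLink r s i j)
    sameLink? i j = (i ≟ r ×-dec j ≟ s) ⊎-dec (i ≟ s ×-dec j ≟ r)

    flip : ∀ {i j} → SameLink r s i j → SameLink r s j i
    flip (inj₁ (p , q)) = inj₂ (q , p)
    flip (inj₂ (p , q)) = inj₁ (q , p)

    loopless : ∀ {i} → ¬ SameLink r s i i
    loopless (inj₁ (refl , refl)) = adj-irrefl G refl rs
    loopless (inj₂ (refl , refl)) = adj-irrefl G refl rs

    sameLink-end : ∀ {i j k} → SameLink r s i j → SameLink r s i k → j ≡ k
    sameLink-end (inj₁ (refl , refl)) (inj₁ (refl , refl)) = refl
    sameLink-end (inj₁ (refl , refl)) (inj₂ (refl , refl)) = refl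
    sameLink-end (inj₂ (refl , refl)) (inj₁ (refl , refl)) = refl
    sameLink-end (inj₂ (refl , refl)) (inj₂ (refl , refl)) = refl

    sameLink-ends : ∀ {i j k l} → SameLink r s i j → SameLink r s k l → k ≢ i → k ≡ j
    sameLink-ends (inj₁ (refl , refl)) (inj₁ (refl , refl)) k≢i = contradiction refl k≢i
    sameLink-ends (inj₁ (refl , refl)) (inj₂ (refl , refl)) k≢i = refl
    sameLink-ends (inj₂ (refl , refl)) (inj₁ (refl , refl)) k≢i = refl
    sameLink-ends (inj₂ (refl , refl)) (inj₂ (refl , refl)) k≢i = contradiction refl k≢i

    module _ (bypassed : Bypassed) where

      bypass : ∀ {i j l} → SameLink r s i j → Adj G i l → l ≢ j → Walk G⁻ l j 2
      bypass {i} {j} {l} same a l≢j = let l′ , a₁ , a₂ , l′≢i = bypassed same a l≢j in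
        (a₁ , λ same′ → l≢j (sameLink-ends same same′ λ { refl → adj-irrefl G refl a })) ∷
        link (a₂ , λ same′ → l′≢i (sameLink-end (flip same′) (flip same)))

      -- A walk that crosses the deleted link and does not end there either turns straight back, and
      -- both steps are dropped, or goes on to a neighbour; these two steps are then replaced by the
      -- other two sides of a 4-cycle. The length never grows.
      reroute : ∀ {i j d} → ¬ SameLink r s i j → Walk G i j d → WalkUpTo G⁻ i j d
      reroute _ [] = 0 , z≤n , []
      reroute {i} {j} ¬same (_∷_ {j = l} a w) with sameLink? i l | sameLink? l j
      reroute ¬same (a ∷ []) | yes same | _ = contradiction same ¬same
      reroute {i} ¬same (_∷_ {j = l} a (_∷_ {j = l₂} b w)) | yes same | _ with l₂ ≟ i
      ... | yes refl = let e , e≤d , w′ = reroute ¬same w in e , ℕ.m≤n⇒m≤1+n (ℕ.m≤n⇒m≤1+n e≤d) , w′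
      ... | no l₂≢i =
        let e , e≤d , w′ = reroute (λ same′ → l₂≢i
              (sameLink-ends (flip same) same′ λ { refl → adj-irrefl G refl b })) w
        in 2 ℕ.+ e , s≤s (s≤s e≤d) , reverse (bypass (flip same) b l₂≢i) ++ w′
      reroute {i} {j} ¬same (_∷_ {j = l} a w) | no ¬same′ | no ¬same″ =
        let e , e≤d , w′ = reroute ¬same″ w in suc e , s≤s e≤d , (a , ¬same′) ∷ w′
      reroute {i} {j} ¬same (a ∷ []) | no ¬same′ | yes same″ = contradiction same″ loopless
      -- The rest of the walk joins the ends of the deleted link, so the recursion does not apply to
      -- it. The walk has at least two steps, though, and the 4-cycle containing i offers two from i
      -- to j.
      reroute {i} {j} ¬same (_∷_ {j = l} a w@(_ ∷ _)) | no ¬same′ | yes same″ with i ≟ j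
      ... | yes refl = 0 , z≤n , []
      ... | no i≢j   = 2 , s≤s (s≤s z≤n) , bypass same″ (adj-sym G a) i≢j

  ½^≤2^-distance : (G : Graph N) {i j : Fin N} → Walk G i j d → ½^ d ≤ 2^-distance G i j
  ½^≤2^-distance G {i} {j} w with distance? G i j
  ... | yes (_ , _ , min) = ½^-antitone (min w)
  ... | no ¬d             = contradiction (shortestWalk G _ w) ¬d

  2^-distance≤½ : (G : Graph N) {i j : Fin N} → i ≢ j → 2^-distance G i j ≤ ½
  2^-distance≤½ G {i} {j} i≢j with distance? G i j
  ... | yes (zero  , [] , _) = contradiction refl i≢j
  ... | yes (suc d , _ , _)  = ½^-antitone {1} {suc d} (s≤s z≤n)
  ... | no _                 = 0≤½^ 1

  module _ (G : Graph N) {r s : Fin N} (rs : Adj G r s) (bypassed : Bypassed G rs)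
           {q : ℚ} (0≤q : 0ℚ ≤ q) (½≤ : ½ ≤ 2^-distance (deleteLink G r s) r s + q) where

    private
      G⁻ : Graph N
      G⁻ = deleteLink G r s

      -- q times the indicator of the two ordered pairs (r , s) and (s , r).
      loss : Fin N → Fin N → ℚ
      loss i j = pick r (pick s q j) i + pick s (pick r q j) i

      0≤pick² : ∀ (r s : Fin N) i j → 0ℚ ≤ pick r (pick s q j) i
      0≤pick² r s i j = pick-nonNeg r (pick-nonNeg s 0≤q j) i

      loss-sym : q ≤ loss r s × q ≤ loss s r
      loss-sym =
        ≤-trans (≤-reflexive (sym (trans (+-identityʳ _) (trans (pick-self r) (pick-self s)))))
                (+-monoʳ-≤ (pick r (pick s q s) r) (0≤pick² s r r s)) ,
        ≤-trans (≤-reflexive (sym (trans (+-identityˡ _) (trans (pick-self s) (pick-self r)))))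
                (+-monoˡ-≤ (pick s (pick r q r) s) (0≤pick² r s s r))

    entry-loss : ∀ i j → offDiagonal (2^-distance G) i j ≤
                         offDiagonal (2^-distance G⁻) i j + loss i j
    entry-loss i j with i ≟ j
    ... | yes _ = +-mono-≤ (≤-refl {0ℚ}) (+-mono-≤ (0≤pick² r s i j) (0≤pick² s r i j))
    ... | no i≢j with sameLink? G rs i j
    ... | no ¬same = ≤-trans (≤-reflexive (sym (+-identityʳ _)))
      (+-mono-≤ (2^-distance-mono (reroute G rs bypassed ¬same))
                (+-mono-≤ (0≤pick² r s i j) (0≤pick² s r i j)))
    ... | yes (inj₁ (refl , refl)) = ≤-trans (2^-distance≤½ G i≢j)
      (≤-trans ½≤ (+-monoʳ-≤ (2^-distance G⁻ i j) (proj₁ loss-sym)))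
    ... | yes (inj₂ (refl , refl)) = ≤-trans (2^-distance≤½ G i≢j)
      (≤-trans ½≤ (≤-trans (≤-reflexive (cong (_+ q) (2^-distance-sym G⁻)))
                           (+-monoʳ-≤ (2^-distance G⁻ i j) (proj₂ loss-sym))))

    closeness-loss : closeness G ≤ closeness G⁻ + (q + q)
    closeness-loss = begin
      closeness G
        ≤⟨ Σ-mono-≤ {N} (λ i → Σ-mono-≤ {N} (entry-loss i)) ⟩
      Σℚ (λ i → Σℚ (λ j → offDiagonal (2^-distance G⁻) i j + loss i j))
        ≡⟨ ΣΣ-distrib-+ (offDiagonal (2^-distance G⁻)) loss ⟩
      closeness G⁻ + Σℚ (λ i → Σℚ (loss i))
        ≡⟨ cong (closeness G⁻ +_) (ΣΣ-distrib-+ (λ i j → pick r (pick s q j) i)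
                                                 (λ i j → pick s (pick r q j) i)) ⟩
      closeness G⁻ + (Σℚ (λ i → Σℚ (λ j → pick r (pick s q j) i))
                    + Σℚ (λ i → Σℚ (λ j → pick s (pick r q j) i)))
        ≡⟨ cong (closeness G⁻ +_) (cong₂ _+_ (ΣΣ-pick r s q) (ΣΣ-pick s r q)) ⟩
      closeness G⁻ + (q + q) ∎
      where open ≤-Reasoning

  -- Rotations of the circle, and the 4-cycles at a chord.

  rotate : Permutation′ N
  rotate {zero}  = Perm.id
  rotate {suc p} = permutation to from to∘from from∘to
    where
    to : Fin (suc p) → Fin (suc p)
    to i with view i
    ... | ‵fromℕ     = zero
    ... | ‵inject₁ i = suc i
    from : Fin (suc p) → Fin (suc p)
    from zero    = Fin.fromℕ p
    from (suc i) = Fin.inject₁ i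
    to∘from : ∀ i → to (from i) ≡ i
    to∘from zero    rewrite view-fromℕ p = refl
    to∘from (suc i) rewrite view-inject₁ i = refl
    from∘to : ∀ i → from (to i) ≡ i
    from∘to i with view i
    ... | ‵fromℕ   = refl
    ... | ‵inj₁ _ = refl

  rotate-next : ∀ (i : Fin N) → suc (toℕ i) ≡ toℕ (rotate ⟨$⟩ʳ i) ⊎
                                (suc (toℕ i) ≡ N × toℕ (rotate ⟨$⟩ʳ i) ≡ 0)
  rotate-next {suc p} i with view i
  ... | ‵fromℕ     = inj₂ (cong suc (Fin.toℕ-fromℕ p) , refl)
  ... | ‵inject₁ i = inj₁ (cong suc (Fin.toℕ-inject₁ i))

  module Circle (n : ℕ) (2≤n : 2 ℕ.≤ n) where

    private
      H : Graph (2 ℕ.* n)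
      H = harary n 2≤n

      V : Set
      V = Fin (2 ℕ.* n)

      variable
        i j i′ j′ r s : V

    ρ ρ⁻¹ : V → V
    ρ   = rotate {2 ℕ.* n} ⟨$⟩ʳ_
    ρ⁻¹ = rotate {2 ℕ.* n} ⟨$⟩ˡ_

    next-ρ : ∀ i → Next n i (ρ i)
    next-ρ = rotate-next {2 ℕ.* n}

    next-ρ⁻¹ : ∀ i → Next n (ρ⁻¹ i) i
    next-ρ⁻¹ i = subst (Next n (ρ⁻¹ i)) (inverseʳ rotate) (next-ρ (ρ⁻¹ i))

    next-unique : Next n i j → Next n i j′ → j ≡ j′
    next-unique (inj₁ p)        (inj₁ q)        = toℕ-injective (trans (sym p) q)
    next-unique {j = j} (inj₁ p) (inj₂ (q , _)) =
      contradiction (trans (sym p) q) (ℕ.<⇒≢ (toℕ<n j))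
    next-unique {j′ = j′} (inj₂ (p , _)) (inj₁ q) =
      contradiction (trans (sym q) p) (ℕ.<⇒≢ (toℕ<n j′))
    next-unique (inj₂ (_ , p))  (inj₂ (_ , q))  = toℕ-injective (trans p (sym q))

    Chord : V → V → Set
    Chord i j = Opposite n i j ⊎ Opposite n j i

    1≤n : 1 ℕ.≤ n
    1≤n = ℕ.<⇒≤ 2≤n

    i+n≡j⇒i<n : Opposite n i j → toℕ i ℕ.< n
    i+n≡j⇒i<n {i} {j} o = ℕ.+-cancelʳ-< n (toℕ i) n
      (subst₂ ℕ._<_ (sym o) (cong (n ℕ.+_) (ℕ.+-identityʳ n)) (toℕ<n j))

    n≤i : Opposite n j i → n ℕ.≤ toℕ i
    n≤i {j} o = subst (n ℕ.≤_) o (ℕ.m≤n+m n (toℕ j))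

    chord-unique : Chord i j → Chord i j′ → j ≡ j′
    chord-unique (inj₁ o) (inj₁ o′) = toℕ-injective (trans (sym o) o′)
    chord-unique {i} (inj₁ o) (inj₂ o′) = contradiction (i+n≡j⇒i<n {i} o) (ℕ.≤⇒≯ (n≤i {_} {i} o′))
    chord-unique {i} (inj₂ o) (inj₁ o′) = contradiction (i+n≡j⇒i<n {i} o′) (ℕ.≤⇒≯ (n≤i {_} {i} o))
    chord-unique (inj₂ o) (inj₂ o′) = toℕ-injective (ℕ.+-cancelʳ-≡ n _ _ (trans o (sym o′)))

    -- Rotation can reverse the orientation of a chord: (n - 1 , 2n - 1) becomes (n , 0). Therefore
    -- the conclusion is `Chord` and not `Opposite`.
    opposite-next : Next n i i′ → Next n j j′ → Opposite n i j → Chord i′ j′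
    opposite-next {i} {i′} {j} {j′} (inj₁ p) (inj₁ q) o =
      inj₁ (trans (cong (ℕ._+ n) (sym p)) (trans (cong suc o) q))
    opposite-next {i} {i′} {j} {j′} (inj₁ p) (inj₂ (q , j′≡0)) o =
      inj₂ (trans (cong (ℕ._+ n) j′≡0) (ℕ.+-cancelʳ-≡ n n (toℕ i′) (begin
        n ℕ.+ n                ≡⟨ cong (n ℕ.+_) (ℕ.+-identityʳ n) ⟨
        2 ℕ.* n                ≡⟨ q ⟨
        suc (toℕ j)            ≡⟨ cong suc o ⟨
        suc (toℕ i) ℕ.+ n      ≡⟨ cong (ℕ._+ n) p ⟩
        toℕ i′ ℕ.+ n           ∎)))
      where open ≡-Reasoning
    opposite-next {i} {i′} {j} {j′} (inj₂ (p , _)) _ o =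
      contradiction (i+n≡j⇒i<n {i} {j} o) (ℕ.≤⇒≯ (ℕ.s≤s⁻¹ (subst (suc n ℕ.≤_) (sym p)
        (subst (suc n ℕ.≤_) (sym (cong (n ℕ.+_) (ℕ.+-identityʳ n))) (ℕ.+-monoˡ-≤ n 1≤n)))))

    chord-next : Next n i i′ → Next n j j′ → Chord i j → Chord i′ j′
    chord-next p q (inj₁ o) = opposite-next p q o
    chord-next p q (inj₂ o) = swap (opposite-next q p o)

    opposite-prev : Next n i i′ → Next n j j′ → Opposite n i′ j′ → Chord i j
    opposite-prev {i} {i′} {j} {j′} (inj₁ p) (inj₁ q) o =
      inj₁ (ℕ.suc-injective (trans (cong (ℕ._+ n) p) (trans o (sym q))))
    opposite-prev {i} {i′} {j} {j′} (inj₂ (p , i′≡0)) (inj₁ q) o = inj₂ (ℕ.suc-injective (begin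
      suc (toℕ j) ℕ.+ n     ≡⟨ cong (ℕ._+ n) q ⟩
      toℕ j′ ℕ.+ n          ≡⟨ cong (ℕ._+ n) o ⟨
      toℕ i′ ℕ.+ n ℕ.+ n    ≡⟨ cong (λ i → i ℕ.+ n ℕ.+ n) i′≡0 ⟩
      n ℕ.+ n               ≡⟨ cong (n ℕ.+_) (ℕ.+-identityʳ n) ⟨
      2 ℕ.* n               ≡⟨ p ⟨
      suc (toℕ i)           ∎))
      where open ≡-Reasoning
    opposite-prev {i} {i′} {j} {j′} _ (inj₂ (_ , j′≡0)) o =
      contradiction (subst (n ℕ.≤_) j′≡0 (n≤i {i′} {j′} o)) (ℕ.<⇒≱ 1≤n)

    chord-prev : Next n i i′ → Next n j j′ → Chord i′ j′ → Chord i j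
    chord-prev p q (inj₁ o) = opposite-prev p q o
    chord-prev p q (inj₂ o) = swap (opposite-prev q p o)

    chord⇒¬next : Chord i j → ¬ Next n i j
    chord⇒¬next {i} {j} (inj₁ o) (inj₁ p) =
      ℕ.<⇒≢ 2≤n (ℕ.+-cancelˡ-≡ (toℕ i) 1 n (trans (ℕ.+-comm (toℕ i) 1) (trans p (sym o))))
    chord⇒¬next {i} {j} (inj₁ o) (inj₂ (_ , j≡0)) = ℕ.<⇒≱ 1≤n (subst (n ℕ.≤_) j≡0 (n≤i {i} {j} o))
    chord⇒¬next {i} {j} (inj₂ o) (inj₁ p) =
      ℕ.<⇒≱ (s≤s (ℕ.m≤m+n (toℕ j) n)) (ℕ.≤-reflexive (trans (cong suc o) p))
    chord⇒¬next {i} {j} (inj₂ o) (inj₂ (p , j≡0)) = ℕ.<⇒≢ 2≤n (ℕ.+-cancelʳ-≡ n 1 n (begin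
      suc n                 ≡⟨ cong (λ j → suc (j ℕ.+ n)) j≡0 ⟨
      suc (toℕ j ℕ.+ n)     ≡⟨ cong suc o ⟩
      suc (toℕ i)           ≡⟨ p ⟩
      2 ℕ.* n               ≡⟨ cong (n ℕ.+_) (ℕ.+-identityʳ n) ⟩
      n ℕ.+ n               ∎))
      where open ≡-Reasoning

    ρ-hom : Adj H i j → Adj H (ρ i) (ρ j)
    ρ-hom {i} {j} (inj₁ (inj₁ p)) with refl ← next-unique p (next-ρ i) = inj₁ (inj₁ (next-ρ (ρ i)))
    ρ-hom {i} {j} (inj₁ (inj₂ p)) with refl ← next-unique p (next-ρ j) = inj₁ (inj₂ (next-ρ (ρ j)))
    ρ-hom {i} {j} (inj₂ c) = inj₂ (chord-next (next-ρ i) (next-ρ j) c)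

    ρ-injective : ρ i ≡ ρ j → i ≡ j
    ρ-injective eq = trans (sym (inverseˡ rotate)) (trans (cong ρ⁻¹ eq) (inverseˡ rotate))

    ρ-sameLink : SameLink (ρ r) (ρ s) (ρ i) (ρ j) → SameLink r s i j
    ρ-sameLink (inj₁ (p , q)) = inj₁ (ρ-injective p , ρ-injective q)
    ρ-sameLink (inj₂ (p , q)) = inj₂ (ρ-injective p , ρ-injective q)

    rim : V → ℚ
    rim i = closeness (deleteLink H i (ρ i))

    rim-rotate : ∀ i → rim i ≤ rim (ρ i)
    rim-rotate i =
      closeness-mono (deleteLink H i (ρ i)) (deleteLink H (ρ i) (ρ (ρ i))) rotate
        λ (a , kept) → ρ-hom a , kept ∘ ρ-sameLink

    module _ {last : V} (1+last≡2n : suc (toℕ last) ≡ 2 ℕ.* n) where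

      ρ-last : toℕ (ρ last) ≡ 0
      ρ-last with next-ρ last
      ... | inj₁ p       = contradiction (trans (sym p) 1+last≡2n) (ℕ.<⇒≢ (toℕ<n (ρ last)))
      ... | inj₂ (_ , p) = p

      -- The one-sided `rim-rotate` is enough: the chain starts at `last`, passes to vertex 0 and
      -- climbs to i.
      last-rim-minimal : ∀ i → rim last ≤ rim i
      last-rim-minimal i = go (toℕ i) i refl
        where
        go : ∀ m i → toℕ i ≡ m → rim last ≤ rim i
        go zero i i≡0 with refl ← toℕ-injective (trans ρ-last (sym i≡0)) = rim-rotate last
        go (suc m) i i≡1+m = ≤-trans (go m (ρ⁻¹ i) (prev (next-ρ⁻¹ i)))
          (subst (λ j → rim (ρ⁻¹ i) ≤ rim j) (inverseʳ rotate) (rim-rotate (ρ⁻¹ i)))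
          where
          prev : Next n (ρ⁻¹ i) i → toℕ (ρ⁻¹ i) ≡ m
          prev (inj₁ p)       = ℕ.suc-injective (trans p i≡1+m)
          prev (inj₂ (_ , p)) = contradiction (trans (sym i≡1+m) p) ℕ.1+n≢0

      next-minimal : Next n r s → rim last ≤ closeness (deleteLink H r s)
      next-minimal {r} p with refl ← next-unique p (next-ρ r) = last-rim-minimal r

      rim-minimal : Next n r s ⊎ Next n s r → rim last ≤ closeness (deleteLink H r s)
      rim-minimal (inj₁ p) = next-minimal p
      rim-minimal {r} {s} (inj₂ p) = ≤-trans (next-minimal p)
        (closeness-mono (deleteLink H s r) (deleteLink H r s) Perm.id
          λ (a , kept) → a , kept ∘ swap)

    module _ {r s : V} (c : Chord r s) where

      private
        rs : Adj H r s
        rs = inj₂ c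

        chord-of : SameLink r s i j → Chord i j
        chord-of (inj₁ (refl , refl)) = c
        chord-of (inj₂ (refl , refl)) = swap c

      chord-bypassed : Bypassed H rs
      chord-bypassed {i} {j} {l} same (inj₁ (inj₁ p)) _ = ρ j ,
        inj₂ (chord-next p (next-ρ j) (chord-of same)) , inj₁ (inj₂ (next-ρ j)) ,
        λ { refl → chord⇒¬next (swap (chord-of same)) (next-ρ j) }
      chord-bypassed {i} {j} {l} same (inj₁ (inj₂ p)) _ = ρ⁻¹ j ,
        inj₂ (chord-prev p (next-ρ⁻¹ j) (chord-of same)) , inj₁ (inj₁ (next-ρ⁻¹ j)) ,
        λ { refl → chord⇒¬next (chord-of same) (next-ρ⁻¹ j) }
      chord-bypassed same (inj₂ c′) l≢j = contradiction (chord-unique c′ (chord-of same)) l≢j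

      next-kept : Next n i j → ¬ SameLink r s i j
      next-kept p same = chord⇒¬next (chord-of same) p

      chord-detour : Walk (deleteLink H r s) r s 3
      chord-detour = (inj₁ (inj₁ (next-ρ r)) , next-kept (next-ρ r)) ∷
        bypass H rs chord-bypassed (inj₁ (refl , refl)) (inj₁ (inj₁ (next-ρ r)))
          λ ρr≡s → chord⇒¬next c (subst (Next n r) ρr≡s (next-ρ r))

      chord-loss : ∀ {q} → 0ℚ ≤ q → Walk (deleteLink H r s) r s d → ½ ≤ ½^ d + q →
                   closeness H ≤ closeness (deleteLink H r s) + (q + q)
      chord-loss {q = q} 0≤q w ½≤ = closeness-loss H rs chord-bypassed 0≤q
        (≤-trans ½≤ (+-monoˡ-≤ q (½^≤2^-distance (deleteLink H r s) w)))

  -- Chord deletions cost no more than rim deletions.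

  -- 3/8 = 1/2 - 1/8 and 1/4 = 1/2 - 1/4 are the losses of an ordered pair that moves from distance
  -- 1 to 3 and to 2. The threshold 9/4 is 3 - 2 (3/8).
  3/8 1/4 9/4 : ℚ
  3/8 = ℤ.+ 3 ℚ./ 8
  1/4 = ½ * ½
  9/4 = fromℕ 9 * 1/4

  last-vertex : ∀ n → 1 ℕ.≤ n → ∃[ v ] suc (toℕ {2 ℕ.* n} v) ≡ 2 ℕ.* n
  last-vertex (suc n) _ = Fin.fromℕ _ , cong suc (Fin.toℕ-fromℕ _)

  -- The induction step of the next two bounds: from k to k + 1 the integer factor at most doubles
  -- while the power of ½ halves.
  halving : ∀ a b d → b ℕ.≤ 2 ℕ.* a → fromℕ b * ½^ suc d ≤ fromℕ a * ½^ d
  halving a b d b≤2a = begin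
    fromℕ b * ½^ suc d
      ≤⟨ *-monoʳ-≤-nonNeg (½^ suc d) ⦃ nonNegative (0≤½^ (suc d)) ⦄ (fromℕ-mono-≤ b≤2a) ⟩
    fromℕ (2 ℕ.* a) * ½^ suc d
      ≡⟨ cong (_* ½^ suc d) (trans (fromℕ-+ a (a ℕ.+ 0)) (cong (fromℕ a +_) (fromℕ-+ a 0))) ⟩
    (fromℕ a + (fromℕ a + 0ℚ)) * (½ * ½^ d)
      ≡⟨ solve 2 (λ a p → (a :+ (a :+ con 0ℚ)) :* (con ½ :* p) := a :* p) refl (fromℕ a) (½^ d) ⟩
    fromℕ a * ½^ d ∎
    where open ≤-Reasoning

  odd-bound : ∀ k → fromℕ (3 ℕ.* (suc k ℕ.+ 2)) * ½^ (2 ℕ.+ k) ≤ 9/4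
  odd-bound zero    = toWitness {a? = (fromℕ 9 * ½^ 2) ≤? 9/4} _
  odd-bound (suc k) = ≤-trans
    (halving (3 ℕ.* (suc k ℕ.+ 2)) (3 ℕ.* (suc (suc k) ℕ.+ 2)) (2 ℕ.+ k)
      (lin (6 ℕ.+ 3 ℕ.* k) (z≤n {0}) (identity k)))
    (odd-bound k)
    where
    identity : ∀ k → 3 ℕ.* (suc (suc k) ℕ.+ 2) ℕ.+ 0 ℕ.+ (6 ℕ.+ 3 ℕ.* k) ≡
               2 ℕ.* (3 ℕ.* (suc k ℕ.+ 2)) ℕ.+ 0
    identity = solve-∀

  -- The shift by 2 leaves out n = 2, whose term 5/2 exceeds 9/4.
  even-bound : ∀ k → fromℕ (2 ℕ.* (2 ℕ.+ k) ℕ.+ 3) * ½^ (2 ℕ.+ k) ≤ 9/4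
  even-bound zero    = toWitness {a? = (fromℕ 7 * ½^ 2) ≤? 9/4} _
  even-bound (suc k) = ≤-trans
    (halving (2 ℕ.* (2 ℕ.+ k) ℕ.+ 3) (2 ℕ.* (2 ℕ.+ suc k) ℕ.+ 3) (2 ℕ.+ k)
      (lin (5 ℕ.+ 2 ℕ.* k) (z≤n {0}) (identity k)))
    (even-bound k)
    where
    identity : ∀ k → 2 ℕ.* (2 ℕ.+ suc k) ℕ.+ 3 ℕ.+ 0 ℕ.+ (5 ℕ.+ 2 ℕ.* k) ≡
               2 ℕ.* (2 ℕ.* (2 ℕ.+ k) ℕ.+ 3) ℕ.+ 0
    identity = solve-∀

  transfer-bound : ∀ {c c⁻ a} q → c ≤ c⁻ + (q + q) → a ≤ fromℕ 3 - (q + q) → c - fromℕ 3 + a ≤ c⁻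
  transfer-bound {c} {c⁻} {a} q c≤ a≤ = begin
    c - fromℕ 3 + a ≤⟨ +-mono-≤ (+-monoˡ-≤ (- fromℕ 3) c≤) a≤ ⟩
    c⁻ + (q + q) - fromℕ 3 + (fromℕ 3 - (q + q))
      ≡⟨ solve 2 (λ c q → c :+ (q :+ q) :- con (fromℕ 3) :+ (con (fromℕ 3) :- (q :+ q)) := c)
               refl c⁻ q ⟩
    c⁻ ∎
    where open ≤-Reasoning

  module _ (n : ℕ) (2≤n : 2 ℕ.≤ n) where
    open Circle n 2≤n

    residual : ∀ {c last} (1+last≡2n : suc (toℕ last) ≡ 2 ℕ.* n) → rim last ≡ c →
               (∀ {r s} → Chord r s → c ≤ closeness (deleteLink (harary n 2≤n) r s)) →
               IsLinkResidualCloseness (harary n 2≤n) c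
    residual {last = last} 1+last≡2n refl chord-bound =
      (last , ρ last , inj₁ (inj₁ (next-ρ last)) , refl) ,
      λ { r s (inj₁ a) → rim-minimal 1+last≡2n a
        ; r s (inj₂ c) → chord-bound c }

    chord-bound : ∀ {a} → a ≤ 9/4 → ∀ {r s} → Chord r s →
                  closeness (harary n 2≤n) - fromℕ 3 + a ≤ closeness (deleteLink (harary n 2≤n) r s)
    chord-bound a≤9/4 {r} {s} c =
      -- Two facts hold by evaluation: ½^ 3 + 3/8 is ½, and 3 - (3/8 + 3/8) is `9/4`.
      transfer-bound 3/8 (chord-loss c (toWitness {a? = 0ℚ ≤? 3/8} _) (chord-detour c) ≤-refl) a≤9/4

  module _ (2≤2 : 2 ℕ.≤ 2) where
    open Circle 2 2≤2

    opposite-two-steps : ∀ {r l s} → Chord r s → Next 2 r l → Next 2 l s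
    opposite-two-steps {r} {l} {s} (inj₁ o) (inj₁ p) =
      inj₁ (trans (cong suc (sym p)) (trans (ℕ.+-comm 2 (toℕ r)) o))
    opposite-two-steps {r} {l} {s} (inj₁ o) (inj₂ (p , _)) with r≡3 ← ℕ.suc-injective p =
      contradiction (toℕ<n s) (ℕ.≤⇒≯ (subst (4 ℕ.≤_) (trans (cong (ℕ._+ 2) (sym r≡3)) o) (ℕ.m≤m+n 4 1)))
    opposite-two-steps {r} {l} {s} (inj₂ o) (inj₂ (p , l≡0)) =
      inj₁ (trans (cong suc l≡0) (sym (ℕ.+-cancelʳ-≡ 2 (toℕ s) 1 (trans o (ℕ.suc-injective p)))))
    opposite-two-steps {r} {l} {s} (inj₂ o) (inj₁ p) = inj₂ (cong suc l≡3 , s≡0)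
      where
      3+s≡l : 3 ℕ.+ toℕ s ≡ toℕ l
      3+s≡l = trans (cong suc (ℕ.+-comm 2 (toℕ s))) (trans (cong suc o) p)
      s≡0 : toℕ s ≡ 0
      s≡0 = ℕ.n≤0⇒n≡0 (ℕ.+-cancelˡ-≤ 3 _ _ (subst (ℕ._≤ 3) (sym 3+s≡l) (ℕ.s≤s⁻¹ (toℕ<n l))))
      l≡3 : toℕ l ≡ 3
      l≡3 = trans (sym 3+s≡l) (cong (3 ℕ.+_) s≡0)

    -- In H₃,₄ = K₄ the ends of a deleted chord are at distance 2 instead of 3, so that
    -- the loss is 1/2, which the bound just allows.
    K₄-chord-bound : ∀ {r s} → Chord r s →
      closeness (harary 2 2≤2) - fromℕ 3 + fromℕ 5 * ½^ 1 ≤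
      closeness (deleteLink (harary 2 2≤2) r s)
    K₄-chord-bound {r} {s} c = transfer-bound 1/4
      (chord-loss c (toWitness {a? = 0ℚ ≤? 1/4} _)
        ((inj₁ (inj₁ p) , next-kept c p) ∷ link (inj₁ (inj₁ p′) , next-kept c p′)) ≤-refl)
      ≤-refl
      where
      p = next-ρ r
      p′ = opposite-two-steps c p

  even-chord-bound : ∀ k (1≤k : 1 ℕ.≤ k) {r s} → Circle.Chord (2 ℕ.* k) (2≤2k 1≤k) r s →
    closeness (harary (2 ℕ.* k) (2≤2k 1≤k)) - fromℕ 3 + fromℕ (2 ℕ.* k ℕ.+ 3) * ½^ k ≤
    closeness (deleteLink (harary (2 ℕ.* k) (2≤2k 1≤k)) r s)
  even-chord-bound (suc zero)    1≤k = K₄-chord-bound (2≤2k 1≤k)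
  even-chord-bound (suc (suc k)) 1≤k = chord-bound (2 ℕ.* (2 ℕ.+ k)) (2≤2k 1≤k) (even-bound k)

  odd-chord-bound : ∀ k (1≤k : 1 ℕ.≤ k) {r s} → Circle.Chord (2 ℕ.* k ℕ.+ 1) (2≤2k+1 1≤k) r s →
    closeness (harary (2 ℕ.* k ℕ.+ 1) (2≤2k+1 1≤k)) - fromℕ 3 + fromℕ (3 ℕ.* (k ℕ.+ 2)) * ½^ (1 ℕ.+ k) ≤
    closeness (deleteLink (harary (2 ℕ.* k ℕ.+ 1) (2≤2k+1 1≤k)) r s)
  odd-chord-bound (suc k) 1≤k = chord-bound (2 ℕ.* suc k ℕ.+ 1) (2≤2k+1 1≤k) (odd-bound k)


open import Data.Nat.Base using (_+_; _*_; _≤_)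

theorem3 : (k : ℕ) (1≤k : 1 ≤ k) →
  let H₃,₄ₖ   = harary (2 * k) (2≤2k 1≤k)
      H₃,₄ₖ₊₂ = harary (2 * k + 1) (2≤2k+1 1≤k)
  in (IsLinkResidualCloseness H₃,₄ₖ
        (closeness H₃,₄ₖ ℚ.- fromℕ 3 ℚ.+ fromℕ (2 * k + 3) ℚ.* ½^ k))
     × (IsLinkResidualCloseness H₃,₄ₖ₊₂
        (closeness H₃,₄ₖ₊₂ ℚ.- fromℕ 3 ℚ.+ fromℕ (3 * (k + 2)) ℚ.* ½^ (1 + k)))
theorem3 k 1≤k =
  (let _ , 1+last≡2n = last-vertex (2 * k) (ℕ.<⇒≤ (2≤2k 1≤k))
   in residual (2 * k) (2≤2k 1≤k) 1+last≡2n
        -- `ρ-last` fixes `first` as `ρ last`, so the graph evaluated here is the one behind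
        -- `rim last`.
        (even-rim 1≤k 1+last≡2n (Circle.ρ-last (2 * k) (2≤2k 1≤k) 1+last≡2n))
        (even-chord-bound k 1≤k)) ,
  (let _ , 1+last≡2n = last-vertex (2 * k + 1) (ℕ.<⇒≤ (2≤2k+1 1≤k))
   in residual (2 * k + 1) (2≤2k+1 1≤k) 1+last≡2n
        (odd-rim 1≤k 1+last≡2n (Circle.ρ-last (2 * k + 1) (2≤2k+1 1≤k) 1+last≡2n))
        (odd-chord-bound k 1≤k))
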